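{- Let $p>32$ be a prime and let $X,Y$ be subsets of $\mathbb{Z}/p\mathbb{Z}$ such that $$|X+Y|=|X|+|Y|+1\le p-5,$$ with $|Y|\ge 4$ and $|X|\ge 5$. If $\ell_1(Y)\le |Y|+2$, then $\ell_1(X)\le |X|+2$.
   Context: For a subset $Z$ of $\mathbb{Z}/p\mathbb{Z}$ and $r\in\mathbb{Z}/p\mathbb{Z}$, $\ell_r(Z)$ denotes the cardinality of the smallest arithmetic progression with difference $r$ containing $Z$. -}

module Defs where

open import Data.Nat using (ℕ; zero; suc; _+_; _*_; _⊓_; NonZero)
open import Data.Nat.DivMod using (_mod_)
open import Data.Fin using (Fin; toℕ; _≟_)
open import Data.Fin.Subset using (Subset; ⁅_⁆; _∪_; ⊥; _∈_)
open import Data.Fin.Subset.Properties using (_⊆?_)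
open import Data.Vec using (lookup; tabulate)
open import Data.Bool using (Bool; _∧_)
open import Data.Bool.ListAction using (any)
open import Data.List using (List; foldr; allFin; upTo; concatMap; map)
open import Relation.Nullary.Decidable using (⌊_⌋; does)

_+ₚ_ : {p : ℕ} .{{_ : NonZero p}} → Fin p → Fin p → Fin p
_+ₚ_ {p} a b = (toℕ a + toℕ b) mod p

_⊕_ : {p : ℕ} .{{_ : NonZero p}} → Subset p → Subset p → Subset p
_⊕_ {p} X Y = tabulate λ z →
  any (λ x → any (λ y → lookup X x ∧ lookup Y y ∧ ⌊ (x +ₚ y) ≟ z ⌋) (allFin p)) (allFin p)

AP : {p : ℕ} .{{_ : NonZero p}} → Fin p → Fin p → ℕ → Subset p
AP a r zero    = ⊥
AP a r (suc k) = ⁅ a ⁆ ∪ AP (a +ₚ r) r k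

-- ℓ r Z : cardinality of the smallest AP with difference r containing Z.
-- Minimum over all starting points a and term counts k ≤ p (k = p already
-- covers all of ℤ/pℤ, so longer progressions add nothing); default p.
ℓ : {p : ℕ} .{{_ : NonZero p}} → Fin p → Subset p → ℕ
ℓ {p} r Z = foldr _⊓_ p
  (concatMap (λ a → concatMap (λ k →
      if' (does (Z ⊆? AP a r k)) (Data.Fin.Subset.∣ AP a r k ∣)) (upTo (suc p))) (allFin p))
  where
  if' : Bool → ℕ → List ℕ
  if' Bool.true  n = n Data.List.∷ Data.List.[]
  if' Bool.false n = Data.List.[]

oneₚ : {p : ℕ} .{{_ : NonZero p}} → Fin p
oneₚ {p} = 1 mod p

{-# OPTIONS --safe #-}

-- Put m = ∣Y∣ + 1 and translate Y into [0, m] so that 0 ∈ Y; it then misses exactly two points h < k of [0, m].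
-- Translate X + Y likewise and mark each i ∈ ℤ/pℤ by 𝐱 if i ∈ X, by 𝐜 if i ∉ X + Y, and by 𝐧 otherwise.
-- A 𝐜 lies at distance at most m after an 𝐱 only if the distance is h or k, and a period has exactly m
-- letters 𝐧. So m + 1 consecutive letters contain at most two 𝐜 if they start with 𝐱, and at most two 𝐱 if
-- they end with 𝐜. Look at a transition: an 𝐱 followed by a 𝐜 with only 𝐧 between them.
-- * If the m letters before its 𝐜 contain no 𝐜 and the m letters after its 𝐱 contain no 𝐱, these two windows
--   use up so many 𝐧 that from the next 𝐱 around to this one at most two letters differ from 𝐱.
-- * If only the first condition holds, too few 𝐧 remain to admit five 𝐜 in a period. Reversing the word and
--   exchanging 𝐱 with 𝐜 turns the other mixed case into this one.
-- * If both conditions fail at every transition, every step from one 𝐜 to a 𝐜 beyond the next 𝐱 costs at least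
--   m - 4 letters 𝐧 and passes at most eight other letters. For m ≥ 9 this leaves at most six 𝐱 and six 𝐜, and
--   since p > 32 the 𝐱 then cluster, which creates a transition without 𝐱 after it. For m ≤ 8 a search over words,
--   started where the density of 𝐧 stays below m/33, finds nothing.
module Submission where

open import Defs
open import Data.Nat using (ℕ; _+_; _∸_; _≤_; _<_; NonZero)
open import Data.Nat.Primality using (Prime)
open import Data.Fin.Subset using (Subset; ∣_∣)
open import Relation.Binary.PropositionalEquality using (_≡_)

open import Data.Nat as ℕ using (zero; suc; _*_; _⊓_; z≤n; s≤s; _≤ᵇ_; _<ᵇ_; _≡ᵇ_)
import Data.Nat.Properties as ℕₚ
open import Data.Nat.DivMod using
  (_/_; _%_; _mod_; m≡m%n+[m/n]*n; m%n<n; m%n%n≡m%n; [m+n]%n≡m%n; [m+kn]%n≡m%n; m<n⇒m%n≡m; %-distribˡ-+)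
open import Data.Nat.Tactic.RingSolver using (solve-∀)
open import Data.Bool using (Bool; true; false; T; _∧_; _∨_; if_then_else_; not)
open import Data.Bool.ListAction using (all; any)
open import Data.Bool.Properties using (T-∧; T-≡; ¬-not)
open import Data.Empty using (⊥; ⊥-elim)
open import Data.Fin as Fin using (Fin; toℕ; zero; suc)
import Data.Fin.Properties as Finₚ
open import Data.Fin.Subset using (_∈_; _⊆_; _∪_; ⁅_⁆)
open import Data.Fin.Subset.Properties using (_⊆?_; x∈⁅x⁆; x∈⁅y⁆⇒x≡y; x∈p∪q⁻; x∈p∪q⁺; ∣⁅x⁆∣≡1; ∣⊥∣≡0; ∉⊥)
open import Data.List as List using (List; []; _∷_; _++_; length; take; allFin; upTo; concatMap)
open import Data.List.Membership.Propositional using (lose; find) renaming (_∈_ to _∈ˡ_)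
open import Data.List.Membership.Propositional.Properties using (∈-upTo⁺; ∈-upTo⁻; ∈-allFin)
open import Data.List.Relation.Unary.Any using (Any; here; there)
open import Data.List.Relation.Unary.Any.Properties using (any⁺; concatMap⁺; concatMap⁻)
open import Data.Maybe using (Maybe; just; nothing)
open import Data.Product using (_×_; _,_; proj₁; proj₂; ∃-syntax)
open import Data.Sum as Sum using (_⊎_; inj₁; inj₂; [_,_]′)
open import Data.Unit using (⊤; tt)
open import Data.Vec as Vec using (Vec; []; _∷_; lookup; zipWith; replicate)
open import Data.Vec.N-ary using (N-ary; _$ⁿ_)
open import Data.Vec.Properties using (lookup∘tabulate; []=⇒lookup; lookup⇒[]=)
open import Function using (_∘_; Equivalence)
open import Relation.Binary.Definitions using (tri<; tri≈; tri>)
open import Relation.Binary.PropositionalEquality using (_≢_; refl; sym; trans; cong; cong₂; subst; subst₂)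
open import Relation.Nullary using (yes; no)
open import Relation.Nullary.Decidable using (fromWitness)

-- Linear arithmetic over ℕ

module LinearArithmetic where

  open import Data.Integer as ℤ using (ℤ; +_; -[1+_])

  infixl 6 _:+_
  infixl 7 _:*_
  infix 4 _:≤_ _:<_ _:≡_

  data Exp (n : ℕ) : Set where
    var  : Fin n → Exp n
    con  : ℕ → Exp n
    _:+_ : Exp n → Exp n → Exp n
    _:*_ : ℕ → Exp n → Exp n

  data Rel (n : ℕ) : Set where
    _:≤_ _:≡_ : Exp n → Exp n → Rel n

  _:<_ : ∀ {n} → Exp n → Exp n → Rel n
  a :< b = con 1 :+ a :≤ b

  ⟦_⟧ : ∀ {n} → Exp n → Vec ℕ n → ℕ
  ⟦ var i ⟧ ρ = lookup ρ i
  ⟦ con k ⟧ ρ = k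
  ⟦ a :+ b ⟧ ρ = ⟦ a ⟧ ρ + ⟦ b ⟧ ρ
  ⟦ k :* a ⟧ ρ = k * ⟦ a ⟧ ρ

  ⟦_⟧ᴿ : ∀ {n} → Rel n → Vec ℕ n → Set
  ⟦ a :≤ b ⟧ᴿ ρ = ⟦ a ⟧ ρ ≤ ⟦ b ⟧ ρ
  ⟦ a :≡ b ⟧ᴿ ρ = ⟦ a ⟧ ρ ≡ ⟦ b ⟧ ρ

  -- Curried, so that a use passes the proofs of the relations as arguments, in the order of the
  -- list.
  Refutation : ∀ {n} → Vec ℕ n → List (Rel n) → Set
  Refutation ρ [] = ⊥
  Refutation ρ (r ∷ rs) = ⟦ r ⟧ᴿ ρ → Refutation ρ rs

  -- Coordinate 0 is the constant term; forms are evaluated at `1 ∷ ρ`.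
  Form : ℕ → Set
  Form n = Vec ℕ (suc n)

  dot : ∀ {m} → Vec ℕ m → Vec ℕ m → ℕ
  dot [] [] = 0
  dot (a ∷ as) (x ∷ xs) = a * x + dot as xs

  unit : ∀ {n} → Fin n → Vec ℕ n
  unit zero = 1 ∷ replicate _ 0
  unit (suc i) = 0 ∷ unit i

  normal : ∀ {n} → Exp n → Form n
  normal (var i) = 0 ∷ unit i
  normal (con k) = k ∷ replicate _ 0
  normal (a :+ b) = zipWith _+_ (normal a) (normal b)
  normal (k :* a) = Vec.map (k *_) (normal a)

  dot-zero : ∀ {m} (xs : Vec ℕ m) → dot (replicate m 0) xs ≡ 0
  dot-zero [] = refl
  dot-zero (x ∷ xs) = dot-zero xs

  dot-unit : ∀ {m} (i : Fin m) xs → dot (unit i) xs ≡ lookup xs i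
  dot-unit zero (x ∷ xs) = trans (cong₂ _+_ (ℕₚ.*-identityˡ x) (dot-zero xs)) (ℕₚ.+-identityʳ x)
  dot-unit (suc i) (x ∷ xs) = dot-unit i xs

  dot-+ : ∀ {m} (as bs xs : Vec ℕ m) → dot (zipWith _+_ as bs) xs ≡ dot as xs + dot bs xs
  dot-+ [] [] [] = refl
  dot-+ (a ∷ as) (b ∷ bs) (x ∷ xs) rewrite dot-+ as bs xs = shuffle a b x (dot as xs) (dot bs xs)
    where
    shuffle : ∀ a b x u v → (a + b) * x + (u + v) ≡ (a * x + u) + (b * x + v)
    shuffle = solve-∀

  dot-* : ∀ {m} k (as xs : Vec ℕ m) → dot (Vec.map (k *_) as) xs ≡ k * dot as xs
  dot-* k [] [] = sym (ℕₚ.*-zeroʳ k)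
  dot-* k (a ∷ as) (x ∷ xs) rewrite dot-* k as xs = shuffle k a x (dot as xs)
    where
    shuffle : ∀ k a x u → k * a * x + k * u ≡ k * (a * x + u)
    shuffle = solve-∀

  normal-correct : ∀ {n} (e : Exp n) ρ → dot (normal e) (1 ∷ ρ) ≡ ⟦ e ⟧ ρ
  normal-correct (var i) ρ = dot-unit i ρ
  normal-correct (con k) ρ = trans (cong₂ _+_ (ℕₚ.*-identityʳ k) (dot-zero ρ)) (ℕₚ.+-identityʳ k)
  normal-correct (a :+ b) ρ =
    trans (dot-+ (normal a) (normal b) (1 ∷ ρ)) (cong₂ _+_ (normal-correct a ρ) (normal-correct b ρ))
  normal-correct (k :* a) ρ =
    trans (dot-* k (normal a) (1 ∷ ρ)) (cong (k *_) (normal-correct a ρ))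

  -- A certificate gives each relation a multiplier; only an equation may get a negative one.
  scaled : ∀ {n} → ℤ → Rel n → Exp n × Exp n
  scaled (+ k) (a :≤ b) = k :* a , k :* b
  scaled (+ k) (a :≡ b) = k :* a , k :* b
  scaled -[1+ k ] (a :≡ b) = suc k :* b , suc k :* a
  scaled -[1+ k ] (a :≤ b) = con 0 , con 0

  combine : ∀ {n} → List ℤ → List (Rel n) → Exp n × Exp n
  combine (z ∷ zs) (r ∷ rs) =
    let l , u = scaled z r ; l′ , u′ = combine zs rs in l :+ l′ , u :+ u′
  combine _ _ = con 0 , con 0

  dominates : ∀ {m} → Vec ℕ m → Vec ℕ m → Bool
  dominates [] [] = true
  dominates (a ∷ as) (b ∷ bs) = (b ≤ᵇ a) ∧ dominates as bs

  -- Variables range over ℕ, so comparing coefficients suffices. Strictness at the constant term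
  -- survives because that coordinate is evaluated at 1.
  exceeds : ∀ {n} → Form n → Form n → Bool
  exceeds (a ∷ as) (b ∷ bs) = (b <ᵇ a) ∧ dominates as bs

  certifies : ∀ {n} → List ℤ → List (Rel n) → Bool
  certifies zs rs = let l , u = combine zs rs in exceeds (normal l) (normal u)

  dominates-sound : ∀ {m} (as bs xs : Vec ℕ m) → T (dominates as bs) → dot bs xs ≤ dot as xs
  dominates-sound [] [] [] _ = z≤n
  dominates-sound (a ∷ as) (b ∷ bs) (x ∷ xs) t with Equivalence.to T-∧ t
  ... | b≤a , rest = ℕₚ.+-mono-≤ (ℕₚ.*-monoˡ-≤ x (ℕₚ.≤ᵇ⇒≤ b a b≤a)) (dominates-sound as bs xs rest)

  exceeds-sound : ∀ {n} (as bs : Form n) ρ → T (exceeds as bs) → dot bs (1 ∷ ρ) < dot as (1 ∷ ρ)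
  exceeds-sound (a ∷ as) (b ∷ bs) ρ t with Equivalence.to T-∧ t
  ... | b<a , rest = ℕₚ.+-mono-<-≤ (ℕₚ.*-monoˡ-< 1 (ℕₚ.<ᵇ⇒< b a b<a)) (dominates-sound as bs ρ rest)

  scaled-sound : ∀ {n} z (r : Rel n) ρ → ⟦ r ⟧ᴿ ρ → ⟦ proj₁ (scaled z r) ⟧ ρ ≤ ⟦ proj₂ (scaled z r) ⟧ ρ
  scaled-sound (+ k) (a :≤ b) ρ h = ℕₚ.*-monoʳ-≤ k h
  scaled-sound (+ k) (a :≡ b) ρ h = ℕₚ.≤-reflexive (cong (k *_) h)
  scaled-sound -[1+ k ] (a :≡ b) ρ h = ℕₚ.≤-reflexive (cong (suc k *_) (sym h))
  scaled-sound -[1+ k ] (a :≤ b) ρ h = z≤n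

  refute : ∀ {n} zs (rs : List (Rel n)) ρ →
           (⟦ proj₁ (combine zs rs) ⟧ ρ ≤ ⟦ proj₂ (combine zs rs) ⟧ ρ → ⊥) → Refutation ρ rs
  refute zs [] ρ k = k (zero-≤ zs)
    where
    zero-≤ : ∀ zs → ⟦ proj₁ (combine zs []) ⟧ ρ ≤ ⟦ proj₂ (combine zs []) ⟧ ρ
    zero-≤ [] = z≤n
    zero-≤ (_ ∷ _) = z≤n
  refute [] (r ∷ rs) ρ k _ = refute [] rs ρ (λ _ → k z≤n)
  refute (z ∷ zs) (r ∷ rs) ρ k h = refute zs rs ρ (λ le → k (ℕₚ.+-mono-≤ (scaled-sound z r ρ h) le))

  -- Fourier–Motzkin elimination finds the multipliers. Nothing has to be proved about it, since `certifies`
  -- checks its output. A row stands for constant + coeffs · x ≤ 0 (or = 0), obtained with the given multipliers.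
  record Row : Set where
    constructor row
    field
      isEq        : Bool
      constant    : ℤ
      coeffs      : List ℤ
      multipliers : List ℤ
  open Row

  axpy : ℤ → List ℤ → ℤ → List ℤ → List ℤ
  axpy s as t bs = List.zipWith (λ a b → s ℤ.* a ℤ.+ t ℤ.* b) as bs

  combineRows : Bool → ℤ → Row → ℤ → Row → Row
  combineRows e s (row _ c as ms) t (row _ d bs ns) =
    row e (s ℤ.* c ℤ.+ t ℤ.* d) (axpy s as t bs) (axpy s ms t ns)

  nonNegative : ℤ → Bool
  nonNegative (+ _) = true
  nonNegative -[1+ _ ] = false

  isZero : ℤ → Bool
  isZero (+ zero) = true
  isZero _ = false

  absurdRow : Row → Maybe (List ℤ)
  absurdRow (row _ (+ suc _) cs ms) = if all nonNegative cs then just ms else nothing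
  absurdRow (row true -[1+ _ ] cs ms) =
    if all (nonNegative ∘ ℤ.-_) cs then just (List.map ℤ.-_ ms) else nothing
  absurdRow _ = nothing

  firstAbsurd : List Row → Maybe (List ℤ)
  firstAbsurd [] = nothing
  firstAbsurd (r ∷ rs) with absurdRow r
  ... | just ms = just ms
  ... | nothing = firstAbsurd rs

  coeff : ℕ → List ℤ → ℤ
  coeff _ [] = + 0
  coeff zero (a ∷ _) = a
  coeff (suc i) (_ ∷ as) = coeff i as

  useful : Row → Bool
  useful (row e c cs _) = not (all (λ z → isZero z ∨ (not e ∧ not (nonNegative z))) cs ∧ not (positive c) )
    where
    positive : ℤ → Bool
    positive (+ suc _) = true
    positive _ = false

  pivotEq : ℕ → Row → Row → Row
  pivotEq i q r = reduce (coeff i (coeffs q)) (coeff i (coeffs r))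
    where
    reduce : ℤ → ℤ → Row
    reduce a (+ zero) = r
    -- The factor of `r` must be positive, since `r` may be an inequality; the equation `q` takes
    -- either sign.
    reduce (+ a) b = combineRows (isEq r) (+ a) r (ℤ.- b) q
    reduce -[1+ a ] b = combineRows (isEq r) (+ suc a) r b q

  findEq : ℕ → List Row → List Row → Maybe (Row × List Row)
  findEq i _ [] = nothing
  findEq i seen (r ∷ rs) =
    if isEq r ∧ not (isZero (coeff i (coeffs r))) then just (r , seen ++ rs) else findEq i (r ∷ seen) rs

  positives negatives zeros : ℕ → List Row → List Row
  positives i = List.filterᵇ (λ r → nonNegative (coeff i (coeffs r)) ∧ not (isZero (coeff i (coeffs r))))
  negatives i = List.filterᵇ (λ r → not (nonNegative (coeff i (coeffs r))))
  zeros i = List.filterᵇ (λ r → isZero (coeff i (coeffs r)))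

  -- The row -x ≤ 0, valid over ℕ. Its multipliers are 0: in a certificate it reappears as the slack
  -- that `dominates` allows.
  unitRow : ℕ → ℕ → ℕ → Row
  unitRow i n m = row false (+ 0) (List.applyUpTo (λ j → if j ℕ.≡ᵇ i then -[1+ 0 ] else + 0) n)
      (List.replicate m (+ 0))

  resolve : ℕ → Row → Row → Row
  resolve i r s = combineRows false (ℤ.- coeff i (coeffs s)) r (coeff i (coeffs r)) s

  eliminate : ℕ → ℕ → ℕ → List Row → List Row
  eliminate n m i rs with findEq i [] rs
  ... | just (q , rest) = List.filterᵇ useful (List.map (pivotEq i q) (unitRow i n m ∷ rest))
  ... | nothing = List.filterᵇ useful (zeros i rs ++
                    (List.concatMap (λ r → List.map (resolve i r) (unitRow i n m ∷ negatives i rs)) (positives i rs)))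

  cost : ℕ → List Row → ℕ
  cost i rs with findEq i [] rs
  ... | just _ = 0
  ... | nothing = suc (List.length (positives i rs) * List.length (negatives i rs))

  cheapest : List Row → ℕ → List ℕ → ℕ × List ℕ
  cheapest rs i [] = i , []
  cheapest rs i (j ∷ js) with cheapest rs j js
  ... | k , ks = if cost i rs ≤ᵇ cost k rs then (i , k ∷ ks) else (k , i ∷ ks)

  search : ℕ → ℕ → ℕ → List ℕ → List Row → List ℤ
  search zero n m is rs = []
  search (suc fuel) n m is rs with firstAbsurd rs
  ... | just ms = ms
  ... | nothing with is
  ...   | [] = []
  ...   | i ∷ js with cheapest rs i js
  ...     | k , ks = search fuel n m ks (eliminate n m k rs)

  toRow : ∀ {n} → ℕ → ℕ → Rel n → Row
  toRow m i r = go r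
    where
    mult : List ℤ
    mult = List.applyUpTo (λ j → if j ℕ.≡ᵇ i then + 1 else + 0) m
    minus : ∀ {k} → Vec ℕ k → Vec ℕ k → List ℤ
    minus as bs = Vec.toList (zipWith (λ a b → a ℤ.⊖ b) as bs)
    build : Bool → List ℤ → Row
    build e [] = row e (+ 0) [] mult
    build e (c ∷ cs) = row e c cs mult
    go : _ → Row
    go (a :≤ b) = build false (minus (normal a) (normal b))
    go (a :≡ b) = build true (minus (normal a) (normal b))

  toRows : ∀ {n} → ℕ → ℕ → List (Rel n) → List Row
  toRows m i [] = []
  toRows m i (r ∷ rs) = toRow m i r ∷ toRows m (suc i) rs

  certificate : ∀ {n} → List (Rel n) → List ℤ
  certificate {n} rs = let m = List.length rs in search (suc n) n m (List.upTo n) (toRows m 0 rs)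

  variables : ∀ n → Vec (Exp n) n
  variables n = Vec.tabulate var

  -- The implicit argument is solved by evaluation: the certificate is found and checked during type
  -- checking.
  linearly : ∀ {n} (rs : List (Rel n)) → {T (certifies (certificate rs) rs)} → ∀ ρ → Refutation ρ rs
  linearly rs {ok} ρ = refute zs rs ρ
    (λ le → ℕₚ.<⇒≱ (subst₂ _<_ (normal-correct u ρ) (normal-correct l ρ) (exceeds-sound (normal l) (normal u) ρ ok))
        le)
    where
    zs = certificate rs
    l = proj₁ (combine zs rs)
    u = proj₂ (combine zs rs)

  linear : ∀ n (sys : N-ary n (Exp n) (List (Rel n))) →
           {T (certifies (certificate (sys $ⁿ variables n)) (sys $ⁿ variables n))} →
           ∀ ρ → Refutation ρ (sys $ⁿ variables n)
  linear n sys {ok} ρ = linearly (sys $ⁿ variables n) {ok} ρ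

open LinearArithmetic using
  (Exp; var; con; _:+_; _:*_; Rel; _:≤_; _:<_; _:≡_; ⟦_⟧; ⟦_⟧ᴿ; Refutation; certifies; certificate; linearly; linear)

-- Counting along prefixes of ℕ

bit : Bool → ℕ
bit true = 1
bit false = 0

pre : (ℕ → Bool) → ℕ → ℕ
pre g zero = 0
pre g (suc i) = bit (g i) + pre g i

module _ (g : ℕ → Bool) where

  pre-hit : ∀ {i} → g i ≡ true → pre g (suc i) ≡ suc (pre g i)
  pre-hit eq rewrite eq = refl

  pre-step : ∀ i → pre g i ≤ pre g (suc i)
  pre-step i = ℕₚ.m≤n+m (pre g i) (bit (g i))

  pre-mono′ : ∀ {i j} → i ℕ.≤′ j → pre g i ≤ pre g j
  pre-mono′ ℕ.≤′-refl = ℕₚ.≤-refl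
  pre-mono′ (ℕ.≤′-step le) = ℕₚ.≤-trans (pre-mono′ le) (pre-step _)

  pre-mono : ∀ {i j} → i ≤ j → pre g i ≤ pre g j
  pre-mono le = pre-mono′ (ℕₚ.≤⇒≤′ le)

  pre-last : ∀ {s} t → s ≤ t → pre g s < pre g t →
             ∃[ c ] s ≤ c × c < t × g c ≡ true × pre g t ≡ suc (pre g c)
  pre-last {s} t s≤t lt with ℕₚ.m≤n⇒m<n∨m≡n s≤t
  ... | inj₂ refl = ⊥-elim (ℕₚ.<-irrefl refl lt)
  pre-last (suc t) _ lt | inj₁ (s≤s s≤t) with g t in eq
  ... | true = t , s≤t , ℕₚ.≤-refl , eq , refl
  ... | false = let c , s≤c , c<t , gc , e = pre-last t s≤t lt in
                c , s≤c , ℕₚ.m≤n⇒m≤1+n c<t , gc , e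

  pre-first : ∀ {s} t → s ≤ t → pre g s < pre g t →
              ∃[ c ] s ≤ c × c < t × g c ≡ true × pre g c ≡ pre g s
  pre-first {s} t s≤t lt with ℕₚ.m≤n⇒m<n∨m≡n s≤t
  ... | inj₂ refl = ⊥-elim (ℕₚ.<-irrefl refl lt)
  pre-first {s} (suc t) _ lt | inj₁ (s≤s s≤t) with pre g s ℕ.<? pre g t
  ... | yes lt′ = let c , s≤c , c<t , gc , e = pre-first t s≤t lt′ in
                  c , s≤c , ℕₚ.m≤n⇒m≤1+n c<t , gc , e
  ... | no ¬lt with g t in eq
  ...   | true = t , s≤t , ℕₚ.≤-refl , eq , ℕₚ.≤-antisym (ℕₚ.≮⇒≥ ¬lt) (pre-mono s≤t)
  ...   | false = ⊥-elim (¬lt lt)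

  pre-none : ∀ {s} t → (∀ j → s ≤ j → j < t → g j ≢ true) → pre g t ≤ pre g s
  pre-none {s} t none with s ℕ.≤? t | pre g s ℕ.<? pre g t
  ... | no s≰t | _ = pre-mono (ℕₚ.<⇒≤ (ℕₚ.≰⇒> s≰t))
  ... | yes _ | no ¬lt = ℕₚ.≮⇒≥ ¬lt
  ... | yes s≤t | yes lt = let c , s≤c , c<t , gc , _ = pre-last t s≤t lt in ⊥-elim (none c s≤c c<t gc)

  pre-one : ∀ {s} t h → (∀ j → s ≤ j → j < t → g j ≡ true → j ≡ h) → pre g t ≤ suc (pre g s)
  pre-one {s} t h one with s ℕ.≤? t | pre g s ℕ.<? pre g t
  ... | no s≰t | _ = ℕₚ.m≤n⇒m≤1+n (pre-mono (ℕₚ.<⇒≤ (ℕₚ.≰⇒> s≰t)))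
  ... | yes _ | no ¬lt = ℕₚ.m≤n⇒m≤1+n (ℕₚ.≮⇒≥ ¬lt)
  ... | yes s≤t | yes lt = let c , s≤c , c<t , gc , e = pre-last t s≤t lt in
    subst (_≤ _) (sym e) (s≤s (pre-none c λ j s≤j j<c gj →
      ℕₚ.<⇒≢ j<c (trans (one j s≤j (ℕₚ.<-trans j<c c<t) gj) (sym (one c s≤c c<t gc)))))

  -- The last hit sits at one of the two places; before it only the other one remains.
  pre-two : ∀ {s} t h k → (∀ j → s ≤ j → j < t → g j ≡ true → j ≡ h ⊎ j ≡ k) → pre g t ≤ suc (suc (pre g s))
  pre-two {s} t h k two with s ℕ.≤? t | pre g s ℕ.<? pre g t
  ... | no s≰t | _ = ℕₚ.m≤n⇒m≤o+n 2 (pre-mono (ℕₚ.<⇒≤ (ℕₚ.≰⇒> s≰t)))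
  ... | yes _ | no ¬lt = ℕₚ.m≤n⇒m≤o+n 2 (ℕₚ.≮⇒≥ ¬lt)
  ... | yes s≤t | yes lt with pre-last t s≤t lt
  ...   | c , s≤c , c<t , gc , e with two c s≤c c<t gc
  ...     | inj₁ refl = subst (_≤ _) (sym e) (s≤s (pre-one c k λ j s≤j j<c gj →
              [ (λ j≡h → ⊥-elim (ℕₚ.<⇒≢ j<c j≡h)) , (λ j≡k → j≡k) ]′ (two j s≤j (ℕₚ.<-trans j<c c<t) gj)))
  ...     | inj₂ refl = subst (_≤ _) (sym e) (s≤s (pre-one c h λ j s≤j j<c gj →
              [ (λ j≡h → j≡h) , (λ j≡k → ⊥-elim (ℕₚ.<⇒≢ j<c j≡k)) ]′ (two j s≤j (ℕₚ.<-trans j<c c<t) gj)))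

  pre-period : ∀ {p} → (∀ i → g (i + p) ≡ g i) → ∀ i → pre g (i + p) ≡ pre g i + pre g p
  pre-period per zero = refl
  pre-period per (suc i) rewrite per i | pre-period per i = sym (ℕₚ.+-assoc (bit (g i)) _ _)

  pre-constant : ∀ {s t i} → pre g t ≤ pre g s → s ≤ i → i < t → g i ≢ true
  pre-constant {s} {t} {i} le s≤i i<t gi = ℕₚ.<⇒≱
    (ℕₚ.<-≤-trans (ℕₚ.≤-<-trans (pre-mono s≤i) (subst (pre g i <_) (sym (pre-hit gi)) ℕₚ.≤-refl)) (pre-mono i<t)) le

pre-cong : ∀ {g h} t → (∀ i → i < t → g i ≡ h i) → pre g t ≡ pre h t
pre-cong zero eq = refl
pre-cong (suc t) eq rewrite eq t ℕₚ.≤-refl | pre-cong t (λ i i<t → eq i (ℕₚ.m≤n⇒m≤1+n i<t)) = refl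

-- Words over 𝐱, 𝐜, 𝐧 and their prefix counts

data Letter : Set where
  𝐱 𝐜 𝐧 : Letter

is : Letter → Letter → Bool
is 𝐱 𝐱 = true
is 𝐜 𝐜 = true
is 𝐧 𝐧 = true
is _ _ = false

is-refl : ∀ l → is l l ≡ true
is-refl 𝐱 = refl
is-refl 𝐜 = refl
is-refl 𝐧 = refl

is⇒≡ : ∀ l m → is l m ≡ true → m ≡ l
is⇒≡ 𝐱 𝐱 _ = refl
is⇒≡ 𝐜 𝐜 _ = refl
is⇒≡ 𝐧 𝐧 _ = refl

𝐱≢𝐜 : 𝐱 ≢ 𝐜
𝐱≢𝐜 ()

is-false : ∀ {l m} → m ≢ l → is l m ≡ false
is-false {l} {m} m≢l with is l m in eq
... | true = ⊥-elim (m≢l (is⇒≡ l m eq))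
... | false = refl

-- The variables standing for the numbers of 𝐱, 𝐜 and 𝐧 before a position, and for the position itself.
record Point (m : ℕ) : Set where
  constructor point
  field
    x c n pos : Fin m

xs cs ns loc : ∀ {m} → Point m → Exp m
xs P = var (Point.x P)
cs P = var (Point.c P)
ns P = var (Point.n P)
loc P = var (Point.pos P)

-- Each point takes four variables: three counts and the position.
size : ℕ → ℕ → ℕ
size zero e = e
size (suc k) e = 4 + size k e

shift : ∀ {m} → Point m → Point (4 + m)
shift (point a b c d) = point (skip a) (skip b) (skip c) (skip d)
  where
  skip : ∀ {m} → Fin m → Fin (4 + m)
  skip i = suc (suc (suc (suc i)))

points : ∀ k e → Vec (Point (size k e)) k
points zero e = []
points (suc k) e =
  point zero (suc zero) (suc (suc zero)) (suc (suc (suc zero))) ∷ Vec.map shift (points k e)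

parameters : ∀ k e → Vec (Exp (size k e)) e
parameters k e = Vec.map var (go k)
  where
  go : ∀ k → Vec (Fin (size k e)) e
  go zero = Vec.tabulate (λ i → i)
  go (suc k) = Vec.map (λ i → suc (suc (suc (suc i)))) (go k)

orderly : ∀ {m k} → Vec (Point m) k → List (Rel m)
orderly [] = []
orderly (P ∷ []) = (xs P :+ cs P :+ ns P :≡ loc P) ∷ []
orderly (P ∷ Q ∷ Ps) =
  (xs P :+ cs P :+ ns P :≡ loc P) ∷
  (xs P :≤ xs Q) ∷ (cs P :≤ cs Q) ∷ (ns P :≤ ns Q) ∷ orderly (Q ∷ Ps)

Ascending : ∀ {k} → Vec ℕ k → Set
Ascending [] = ⊤
Ascending (q ∷ []) = ⊤
Ascending (q ∷ r ∷ qs) = q ≤ r × Ascending (r ∷ qs)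

module Counting (f : ℕ → Letter) where

  # : Letter → ℕ → ℕ
  # l = pre (λ i → is l (f i))

  A B D : ℕ → ℕ
  A = # 𝐱
  B = # 𝐜
  D = # 𝐧

  #-mono : ∀ l {i j} → i ≤ j → # l i ≤ # l j
  #-mono l = pre-mono _

  #-hit : ∀ {l i} → f i ≡ l → # l (suc i) ≡ suc (# l i)
  #-hit {l} eq = pre-hit (λ i → is l (f i)) (trans (cong (is l) eq) (is-refl l))

  apart : ∀ {i j} → f i ≡ 𝐱 → f j ≡ 𝐜 → i ≢ j
  apart fi fj refl = 𝐱≢𝐜 (trans (sym fi) fj)

  #-skip : ∀ {i} → f i ≡ 𝐱 → B (suc i) ≡ B i
  #-skip {i} eq = cong (λ l → bit (is 𝐜 l) + B i) eq

  #-skip-c : ∀ {i} → f i ≡ 𝐜 → A (suc i) ≡ A i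
  #-skip-c {i} eq = cong (λ l → bit (is 𝐱 l) + A i) eq

  total : ∀ i → A i + B i + D i ≡ i
  total zero = refl
  total (suc i) with f i | total i
  ... | 𝐱 | t = cong suc t
  ... | 𝐜 | t = trans (cong (_+ D i) (ℕₚ.+-suc (A i) (B i))) (cong suc t)
  ... | 𝐧 | t = trans (ℕₚ.+-suc (A i + B i) (D i)) (cong suc t)

  first : ∀ l {s} t → s ≤ t → # l s < # l t → ∃[ c ] s ≤ c × c < t × f c ≡ l × # l c ≡ # l s
  first l t s≤t lt = let c , s≤c , c<t , gc , e = pre-first _ t s≤t lt in
    c , s≤c , c<t , is⇒≡ l _ gc , e

  last : ∀ l {s} t → s ≤ t → # l s < # l t → ∃[ c ] s ≤ c × c < t × f c ≡ l × # l t ≡ suc (# l c)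
  last l t s≤t lt = let c , s≤c , c<t , gc , e = pre-last _ t s≤t lt in
    c , s≤c , c<t , is⇒≡ l _ gc , e

  none : ∀ l {s} t → (∀ j → s ≤ j → j < t → f j ≢ l) → # l t ≤ # l s
  none l t nowhere = pre-none _ t λ j s≤j j<t → nowhere j s≤j j<t ∘ is⇒≡ l _

  one : ∀ l {s} t h → (∀ j → s ≤ j → j < t → f j ≡ l → j ≡ h) → # l t ≤ suc (# l s)
  one l t h on = pre-one _ t h λ j s≤j j<t → on j s≤j j<t ∘ is⇒≡ l _

  two : ∀ l {s} t h k → (∀ j → s ≤ j → j < t → f j ≡ l → j ≡ h ⊎ j ≡ k) → # l t ≤ suc (suc (# l s))
  two l t h k tw = pre-two _ t h k λ j s≤j j<t → tw j s≤j j<t ∘ is⇒≡ l _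

  constant : ∀ l {s t i} → # l t ≤ # l s → s ≤ i → i < t → f i ≢ l
  constant l le s≤i i<t refl = pre-constant _ le s≤i i<t (is-refl l)

  env : ∀ {k e} → Vec ℕ k → Vec ℕ e → Vec ℕ (size k e)
  env [] ps = ps
  env (q ∷ qs) ps = A q ∷ B q ∷ D q ∷ q ∷ env qs ps

  Denotes : ∀ {m} → Vec ℕ m → Point m → ℕ → Set
  Denotes ρ P q =
    ⟦ xs P ⟧ ρ ≡ A q × ⟦ cs P ⟧ ρ ≡ B q × ⟦ ns P ⟧ ρ ≡ D q × ⟦ loc P ⟧ ρ ≡ q

  data AllDenote {m} (ρ : Vec ℕ m) : ∀ {k} → Vec (Point m) k → Vec ℕ k → Set where
    []  : AllDenote ρ [] []
    _∷_ : ∀ {k P q} {Ps : Vec (Point m) k} {qs} →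
          Denotes ρ P q → AllDenote ρ Ps qs → AllDenote ρ (P ∷ Ps) (q ∷ qs)

  weaken : ∀ {m k a b c d} {ρ : Vec ℕ m} {Ps : Vec (Point m) k} {qs} →
           AllDenote ρ Ps qs → AllDenote (a ∷ b ∷ c ∷ d ∷ ρ) (Vec.map shift Ps) qs
  weaken [] = []
  weaken (den ∷ dens) = den ∷ weaken dens

  points-denote : ∀ {k e} (qs : Vec ℕ k) (ps : Vec ℕ e) → AllDenote (env qs ps) (points k e) qs
  points-denote [] ps = []
  points-denote (q ∷ qs) ps = (refl , refl , refl , refl) ∷ weaken (points-denote qs ps)

  total-at : ∀ {i j k l q} → i ≡ A q → j ≡ B q → k ≡ D q → l ≡ q → i + j + k ≡ l
  total-at refl refl refl refl = total _

  mono-at : ∀ l {i j q r} → i ≡ # l q → j ≡ # l r → q ≤ r → i ≤ j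
  mono-at l refl refl = #-mono l

  discharge : ∀ {m k} {ρ : Vec ℕ m} {Ps : Vec (Point m) k} {qs} → AllDenote ρ Ps qs → Ascending qs →
              ∀ rs → Refutation ρ (orderly Ps ++ rs) → Refutation ρ rs
  discharge [] _ rs ref = ref
  discharge ((a , b , d , e) ∷ []) _ rs ref = ref (total-at a b d e)
  discharge ((a , b , d , e) ∷ dens@((a′ , b′ , d′ , _) ∷ _)) (q≤r , asc) rs ref =
    discharge dens asc rs
      (ref (total-at a b d e) (mono-at 𝐱 a a′ q≤r) (mono-at 𝐜 b b′ q≤r) (mono-at 𝐧 d d′ q≤r))

  -- Refutes a linear system in the prefix counts at the positions qs and in the parameters ps; monotonicity of
  -- the counts and A q + B q + D q ≡ q come for free.
  timeline : ∀ {k e} (qs : Vec ℕ k) → Ascending qs → (ps : Vec ℕ e)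
             (sys : N-ary k (Point (size k e)) (N-ary e (Exp (size k e)) (List (Rel (size k e))))) →
             let rs = (sys $ⁿ points k e) $ⁿ parameters k e; all = orderly (points k e) ++ rs in
             {T (certifies (certificate all) all)} → Refutation (env qs ps) rs
  timeline {k} {e} qs asc ps sys {ok} =
    discharge (points-denote qs ps) asc _
      (linearly (orderly (points k e) ++ ((sys $ⁿ points k e) $ⁿ parameters k e)) {ok} (env qs ps))

-- In terms of the theorem, m = ∣Y∣ + 1, the missing points of Y are h and k, A p = ∣X∣ and B p = p - ∣X + Y∣.
record Configuration : Set where
  field
    f       : ℕ → Letter
    p m h k : ℕ
  open Counting f public
  field
    period : ∀ i → f (i + p) ≡ f i
    valid  : ∀ i j → f i ≡ 𝐱 → f (i + j) ≡ 𝐜 → j ≤ m → j ≡ h ⊎ j ≡ k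
    h<k    : h < k
    1≤h    : 1 ≤ h
    k≤m    : k ≤ m
    5≤m    : 5 ≤ m
    32<p   : 32 < p
    D-p    : D p ≡ m
    5≤A-p  : 5 ≤ A p
    5≤B-p  : 5 ≤ B p

-- Exhaustive search over words

-- The head of a list of letters is the latest one.

tally : Letter → List Letter → ℕ
tally l [] = 0
tally l (a ∷ w) = bit (is l a) + tally l w

-- Walks back from a new 𝐜: `d` is the current distance, the next argument the number of letters
-- still to inspect.
compatible : ℕ → ℕ → ℕ → ℕ → List Letter → Bool
compatible h k d zero w = true
compatible h k d (suc r) [] = true
compatible h k d (suc r) (a ∷ w) =
  (not (is 𝐱 a) ∨ ((d ≡ᵇ h) ∨ (d ≡ᵇ k))) ∧ compatible h k (suc d) r w

admissible : ℕ → ℕ → ℕ → Letter → List Letter → Bool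
admissible m h k 𝐜 w = compatible h k 1 m w
admissible m h k _ w = true

triple : Letter → Letter → List Letter → Bool
triple t l (a ∷ b ∷ _) = is t l ∧ (is t a ∧ is t b)
triple t l _ = false

every : (Letter → Bool) → Bool
every P = P 𝐱 ∧ (P 𝐜 ∧ P 𝐧)

-- The value `true` means that every branch dies: a word that is `done` and a branch that exhausts
-- the fuel both give `false`.
explore : (List Letter → Bool) → (Letter → List Letter → Bool) → ℕ → List Letter → Bool
explore done allowed zero w = false
explore done allowed (suc r) w =
  not (done w) ∧ every (λ l → if allowed l w then explore done allowed r (l ∷ w) else true)

-- 33 stands in for the period, of which only 32 < p is known.
steep : ℕ → ℕ → ℕ → Letter → List Letter → Bool
steep m h k l w =
  (33 * tally 𝐧 (l ∷ w) ≤ᵇ m * suc (length w)) ∧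
  (not (triple 𝐱 l w) ∧ (not (triple 𝐜 l w) ∧ admissible m h k l w))

-- Letter number m, counted from 0, is the 𝐜 of the transition.
opened : ℕ → Letter → List Letter → Bool
opened m l w = if length w <ᵇ m then not (is 𝐜 l) else (if length w ≡ᵇ m then is 𝐜 l else true)

-- The word starts m letters before the 𝐜 of a transition without earlier 𝐜 nearby.
wide : ℕ → ℕ → ℕ → Letter → List Letter → Bool
wide m h k l w =
  (tally 𝐧 (l ∷ w) ≤ᵇ m) ∧ (opened m l w ∧ (not ((m + 2 <ᵇ length w) ∧ triple 𝐱 l w) ∧
  ((suc (length w) <ᵇ m) ∨ any (is 𝐱) (take m (l ∷ w))) ∧ admissible m h k l w))

wideSearch steepSearch : ℕ → ℕ → ℕ → ℕ → Bool
wideSearch m r h k = explore (λ w → 5 ≤ᵇ tally 𝐜 w) (wide m h k) r []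
steepSearch m r h k = explore (λ _ → false) (steep m h k) r []

pairsWith : (ℕ → ℕ → Bool) → ℕ → ℕ → Bool
pairsWith P b zero = true
pairsWith P b (suc a) = P (suc a) b ∧ pairsWith P b a

pairs : ℕ → (ℕ → ℕ → Bool) → Bool
pairs zero P = true
pairs (suc b) P = pairsWith P (suc b) b ∧ pairs b P

∧-true : ∀ {a b} → a ≡ true → b ≡ true → a ∧ b ≡ true
∧-true refl refl = refl

∧-true⁻ˡ : ∀ a {b} → a ∧ b ≡ true → a ≡ true
∧-true⁻ˡ true _ = refl

∧-true⁻ʳ : ∀ a {b} → a ∧ b ≡ true → b ≡ true
∧-true⁻ʳ true eq = eq

pairsWith-sound : ∀ P b a → pairsWith P b a ≡ true → ∀ {h} → 1 ≤ h → h ≤ a → P h b ≡ true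
pairsWith-sound P b zero _ 1≤h h≤0 with ℕₚ.≤-trans 1≤h h≤0
... | ()
pairsWith-sound P b (suc a) eq 1≤h h≤ with ℕₚ.m≤n⇒m<n∨m≡n h≤
... | inj₁ h< = pairsWith-sound P b a (∧-true⁻ʳ (P (suc a) b) eq) 1≤h (ℕₚ.≤-pred h<)
... | inj₂ refl = ∧-true⁻ˡ (P (suc a) b) eq

pairs-sound : ∀ b P → pairs b P ≡ true → ∀ {h k} → 1 ≤ h → h < k → k ≤ b → P h k ≡ true
pairs-sound zero P _ _ h<k k≤0 with ℕₚ.≤-trans h<k k≤0
... | ()
pairs-sound (suc b) P eq {h} {k} 1≤h h<k k≤ with ℕₚ.m≤n⇒m<n∨m≡n k≤
... | inj₁ k< = pairs-sound b P (∧-true⁻ʳ (pairsWith P (suc b) b) eq) 1≤h h<k (ℕₚ.≤-pred k<)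
... | inj₂ refl = pairsWith-sound P (suc b) b (∧-true⁻ˡ (pairsWith P (suc b) b) eq) 1≤h (ℕₚ.≤-pred h<k)

every-sound : ∀ P → every P ≡ true → ∀ l → P l ≡ true
every-sound P eq 𝐱 = ∧-true⁻ˡ (P 𝐱) eq
every-sound P eq 𝐜 = ∧-true⁻ˡ (P 𝐜) (∧-true⁻ʳ (P 𝐱) eq)
every-sound P eq 𝐧 = ∧-true⁻ʳ (P 𝐜) (∧-true⁻ʳ (P 𝐱) eq)

module Scan (f : ℕ → Letter) (s : ℕ) where
  open Counting f

  word : ℕ → List Letter
  word zero = []
  word (suc i) = f (i + s) ∷ word i

  length-word : ∀ i → length (word i) ≡ i
  length-word zero = refl
  length-word (suc i) = cong suc (length-word i)

  tally-word : ∀ l i → tally l (word i) + # l s ≡ # l (i + s)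
  tally-word l zero = refl
  tally-word l (suc i) = trans (ℕₚ.+-assoc (bit (is l (f (i + s)))) _ _)
      (cong (bit (is l (f (i + s))) +_) (tally-word l i))

  -- The word `f` read from `s` is itself a branch that stays allowed until it is done, so the
  -- search cannot have closed all branches.
  explore-sound : ∀ {done allowed} →
    (∀ i → done (word i) ≡ false → allowed (f (i + s)) (word i) ≡ true) →
    ∀ r i → explore done allowed r (word i) ≡ true → ⊥
  explore-sound {done} {allowed} ok (suc r) i eq with done (word i) in unfinished
  ... | false = explore-sound {done} {allowed} ok r (suc i)
      (trans (sym (cong (λ b → if b then explore done allowed r (word (suc i)) else true) (ok i unfinished)))
                  (every-sound (λ l → if allowed l (word i) then explore done allowed r (l ∷ word i) else true) eq
                      (f (i + s))))

  -- The first equation places the head of `word i` at distance `d` before `c`; the second ends the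
  -- walk at distance m.
  compatible-word : ∀ {h k m c} → (∀ j → f j ≡ 𝐱 → j ≤ c → c ≤ j + m → c ≡ j + h ⊎ c ≡ j + k) →
    ∀ i d r → i + s + d ≡ suc c → d + r ≡ suc m → compatible h k d r (word i) ≡ true
  compatible-word hole i d zero _ _ = refl
  compatible-word hole zero d (suc r) _ _ = refl
  compatible-word {h} {k} {m} {c} hole (suc i) d (suc r) at len =
    ∧-true ok (compatible-word hole i (suc d) r (trans (ℕₚ.+-suc (i + s) d) at) (trans (sym (ℕₚ.+-suc d r)) len))
    where
    j = i + s
    at′ : j + d ≡ c
    at′ = ℕₚ.suc-injective at
    d≤m : d ≤ m
    d≤m = ℕₚ.≤-pred (ℕₚ.≤-trans (ℕₚ.≤-trans (s≤s (ℕₚ.m≤m+n d r)) (ℕₚ.≤-reflexive (sym (ℕₚ.+-suc d r))))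
        (ℕₚ.≤-reflexive len))
    distance : ∀ e → c ≡ j + e → d ≡ e
    distance e eq = ℕₚ.+-cancelˡ-≡ j d e (trans at′ eq)
    self : ∀ e → (e ≡ᵇ e) ≡ true
    self e = Equivalence.to T-≡ (ℕₚ.≡⇒≡ᵇ e e refl)
    ∨-trueʳ : ∀ a → a ∨ true ≡ true
    ∨-trueʳ true = refl
    ∨-trueʳ false = refl
    holes : c ≡ j + h ⊎ c ≡ j + k → (d ≡ᵇ h) ∨ (d ≡ᵇ k) ≡ true
    holes (inj₁ eq) with distance h eq
    ... | refl rewrite self d = refl
    holes (inj₂ eq) with distance k eq
    ... | refl rewrite self d = ∨-trueʳ (d ≡ᵇ h)
    ok : not (is 𝐱 (f j)) ∨ ((d ≡ᵇ h) ∨ (d ≡ᵇ k)) ≡ true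
    ok with is 𝐱 (f j) in eq
    ... | false = refl
    ... | true = holes (hole j (is⇒≡ 𝐱 _ eq) (subst (j ≤_) at′ (ℕₚ.m≤m+n j d))
                   (subst (_≤ j + m) at′ (ℕₚ.+-monoʳ-≤ j d≤m)))

  admissible-word : ∀ {m h k} i →
    (f (i + s) ≡ 𝐜 → ∀ j → f j ≡ 𝐱 → j ≤ i + s → i + s ≤ j + m → i + s ≡ j + h ⊎ i + s ≡ j + k) →
    admissible m h k (f (i + s)) (word i) ≡ true
  admissible-word i hole with f (i + s)
  ... | 𝐱 = refl
  ... | 𝐧 = refl
  ... | 𝐜 = compatible-word (hole refl) i 1 _ (ℕₚ.+-comm (i + s) 1) refl

  triple-word : ∀ t i → (∀ j → 2 + j ≡ i → f (j + s) ≡ t → f (suc j + s) ≡ t → f (i + s) ≡ t → ⊥) →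
    triple t (f (i + s)) (word i) ≡ false
  triple-word t zero _ = refl
  triple-word t (suc zero) _ = refl
  triple-word t (suc (suc i)) not-thrice
    with is t (f (2 + i + s)) in e₂ | is t (f (1 + i + s)) in e₁ | is t (f (i + s)) in e₀
  ... | false | _ | _ = refl
  ... | true | false | _ = refl
  ... | true | true | false = refl
  ... | true | true | true = ⊥-elim (not-thrice i refl (is⇒≡ t _ e₀) (is⇒≡ t _ e₁) (is⇒≡ t _ e₂))

  any-word : ∀ t r j → # t (j + s) < # t (r + j + s) → any (is t) (take r (word (r + j))) ≡ true
  any-word t zero j lt = ⊥-elim (ℕₚ.<-irrefl refl lt)
  any-word t (suc r) j lt with is t (f (r + j + s))
  ... | true = refl
  ... | false = any-word t r j lt

  window-word : ∀ {t} r i → (∀ j → r + j ≡ i → # t (j + s) < # t (i + s)) →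
    (i <ᵇ r) ∨ any (is t) (take r (word i)) ≡ true
  window-word {t} r i pos with i <ᵇ r in eq
  ... | true = refl
  ... | false = subst (λ n → any (is t) (take r (word n)) ≡ true) (ℕₚ.m+[n∸m]≡n r≤i)
      (any-word t r (i ∸ r) (subst (λ n → # t (i ∸ r + s) < # t (n + s)) (sym (ℕₚ.m+[n∸m]≡n r≤i))
          (pos (i ∸ r) (ℕₚ.m+[n∸m]≡n r≤i))))
    where
    r≤i : r ≤ i
    r≤i = ℕₚ.≮⇒≥ λ i<r → subst T eq (ℕₚ.<⇒<ᵇ i<r)

-- Transitions with a long gap on both sides

module Core (cfg : Configuration) where
  open Configuration cfg public

  #-shift : ∀ l i → # l (i + p) ≡ # l i + # l p
  #-shift l = pre-period _ (cong (is l) ∘ period)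

  D-shift : ∀ i → D (i + p) ≡ D i + m
  D-shift i = trans (#-shift 𝐧 i) (cong (D i +_) D-p)

  -- A period contains five 𝐱 besides its m letters 𝐧.
  m<p : m < p
  m<p = ℕₚ.≰⇒> λ p≤m → timeline (p ∷ []) tt (m ∷ [])
    (λ P m → (ns P :≡ m) ∷ (loc P :≤ m) ∷ (con 5 :≤ xs P) ∷ []) D-p p≤m 5≤A-p

  m≤p : m ≤ p
  m≤p = ℕₚ.<⇒≤ m<p

  hole : ∀ {x c} → f x ≡ 𝐱 → f c ≡ 𝐜 → x ≤ c → c ≤ x + m → c ≡ x + h ⊎ c ≡ x + k
  hole {x} {c} fx fc x≤c c≤x+m with valid x (c ∸ x) fx (trans (cong f (ℕₚ.m+[n∸m]≡n x≤c)) fc)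
                                      (ℕₚ.m≤n+o⇒m∸n≤o c x c≤x+m)
  ... | inj₁ eq = inj₁ (trans (sym (ℕₚ.m+[n∸m]≡n x≤c)) (cong (x +_) eq))
  ... | inj₂ eq = inj₂ (trans (sym (ℕₚ.m+[n∸m]≡n x≤c)) (cong (x +_) eq))

  -- Up to distance m after an 𝐱, only the distances h and k are open to a 𝐜.
  forward : ∀ {x y} → f x ≡ 𝐱 → y ≤ suc (x + m) → B y ≤ 2 + B x
  forward {x} {y} fx y≤ = two 𝐜 y (x + h) (x + k) λ j x≤j j<y fj →
    hole fx fj x≤j (ℕₚ.≤-pred (ℕₚ.≤-trans j<y y≤))

  -- The mirror image of `forward`: only d - h and d - k can hold an 𝐱.
  backward : ∀ {v d} → f d ≡ 𝐜 → d ≤ v + m → A d ≤ 2 + A v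
  backward {v} {d} fd d≤ = two 𝐱 d (d ∸ h) (d ∸ k) λ j v≤j j<d fj →
    [ (λ eq → inj₁ (back j h eq)) , (λ eq → inj₂ (back j k eq)) ]′
      (hole fj fd (ℕₚ.<⇒≤ j<d) (ℕₚ.≤-trans d≤ (ℕₚ.+-monoˡ-≤ m v≤j)))
    where
    back : ∀ j i → d ≡ j + i → j ≡ d ∸ i
    back j i eq = trans (sym (ℕₚ.m+n∸n≡m j i)) (cong (_∸ i) (sym eq))

  -- No interval of ∣X∣ + 2 positions contains all of X.
  Spread : Set
  Spread = ∀ s → A (s + (A p + 2)) < A s + A p

  -- The two equations on counts say that only 𝐧 stand strictly between `x` and `c`.
  record Transition (x c : ℕ) : Set where
    field
      x<c : x < c
      fx  : f x ≡ 𝐱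
      fc  : f c ≡ 𝐜
      A-c : A c ≡ suc (A x)
      B-c : B c ≡ B x

  -- If three letters from the next 𝐱 (at x′) to z differ from 𝐱, one of them is a 𝐜 (at d). The windows
  -- [u, c] and [x, y) leave too few 𝐧 to fill the positions before d.
  module WideTransition {u x : ℕ} (tr : Transition x (u + m)) (B-u : B (u + m) ≡ B u)
                        (A-y : A (suc (x + m)) ≡ suc (A x)) (spread : Spread) where
    open Transition tr
    c y z q : ℕ
    c = u + m
    y = suc (x + m)
    z = x + p
    q = u + p

    fz : f z ≡ 𝐱
    fz = trans (period x) fx

    y≤1+z : y ≤ suc z
    y≤1+z = s≤s (ℕₚ.+-monoʳ-≤ x m≤p)

    A-1+z : A (suc z) ≡ suc (A x + A p)
    A-1+z = trans (#-hit fz) (cong suc (#-shift 𝐱 x))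

    next-x : ∃[ x′ ] y ≤ x′ × x′ < suc z × f x′ ≡ 𝐱 × A x′ ≡ A y
    next-x = first 𝐱 (suc z) y≤1+z (ℕₚ.≰⇒> λ le → linear 4
      (λ Ay Az Ax Ap → (Az :≤ Ay) ∷ (Ay :≡ con 1 :+ Ax) ∷ (Az :≡ con 1 :+ (Ax :+ Ap)) ∷ (con 5 :≤ Ap) ∷ [])
      (A y ∷ A (suc z) ∷ A x ∷ A p ∷ []) le A-y A-1+z 5≤A-p)

    x′ : ℕ
    x′ = proj₁ next-x
    y≤x′ : y ≤ x′
    y≤x′ = proj₁ (proj₂ next-x)
    x′≤z : x′ ≤ z
    x′≤z = ℕₚ.≤-pred (proj₁ (proj₂ (proj₂ next-x)))
    fx′ : f x′ ≡ 𝐱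
    fx′ = proj₁ (proj₂ (proj₂ (proj₂ next-x)))
    A-x′ : A x′ ≡ A y
    A-x′ = proj₂ (proj₂ (proj₂ (proj₂ next-x)))
    x≤y : x ≤ y
    x≤y = ℕₚ.m≤n⇒m≤1+n (ℕₚ.m≤m+n x m)

    -- Otherwise the `A p + 2` positions from x′ on would include z and hold all `A p` letters 𝐱 of
    -- a period, against `spread`.
    long : x′ + (A p + 2) ≤ z
    long = ℕₚ.≮⇒≥ λ z< → linear 6
      (λ Ax Ay Ax′ Ap Az As → (Ax′ :≡ Ay) ∷ (Ay :≡ con 1 :+ Ax) ∷ (Az :≡ con 1 :+ (Ax :+ Ap)) ∷
        (Az :≤ As) ∷ (As :< Ax′ :+ Ap) ∷ [])
      (A x ∷ A y ∷ A x′ ∷ A p ∷ A (suc z) ∷ A (x′ + (A p + 2)) ∷ [])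
      A-x′ A-y A-1+z (#-mono 𝐱 z<) (spread x′)

    -- Here y ≤ c, so [x, y) consists of one 𝐱 and all m letters 𝐧 of the period. But the m letters
    -- before the 𝐜 at d hold at most two 𝐱 and two 𝐜, hence one more 𝐧 because m ≥ 5.
    no-far : x < u → ⊥
    no-far x<u = timeline (x ∷ y ∷ x′ ∷ v ∷ d ∷ z ∷ [])
      (x≤y , y≤x′ , x′≤v , ℕₚ.m∸n≤m d m , ℕₚ.<⇒≤ d<z , tt) (m ∷ [])
      (λ X Y X′ V E Z m → (loc Y :≡ con 1 :+ (loc X :+ m)) ∷ (xs Y :≡ con 1 :+ xs X) ∷ (cs Y :≤ cs X) ∷
        (ns Z :≡ ns X :+ m) ∷ (xs E :≤ con 2 :+ xs V) ∷ (cs E :≤ con 2 :+ cs X′) ∷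
        (loc V :+ m :≡ loc E) ∷ (con 5 :≤ m) ∷ [])
      refl A-y By≤Bx (D-shift x) (backward fd (ℕₚ.≤-reflexive (sym v+m≡d)))
      (ℕₚ.≤-trans (ℕₚ.≤-reflexive B-d) (forward fx′ ℕₚ.≤-refl)) v+m≡d 5≤m
      where
      By≤Bx : B y ≤ B x
      By≤Bx = ℕₚ.≤-trans (#-mono 𝐜 (ℕₚ.+-monoˡ-≤ m x<u)) (ℕₚ.≤-reflexive B-c)
      -- No 𝐧 is left from x′ to z, so the three letters other than 𝐱 provided by `long` are all 𝐜.
      three : 3 + B x′ ≤ B z
      three = ℕₚ.≮⇒≥ λ lt → timeline (x ∷ y ∷ x′ ∷ z ∷ []) (x≤y , y≤x′ , x′≤z , tt) (m ∷ A p ∷ [])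
        (λ X Y X′ Z m Ap → (loc Y :≡ con 1 :+ (loc X :+ m)) ∷ (xs Y :≡ con 1 :+ xs X) ∷ (cs Y :≤ cs X) ∷
          (ns Z :≡ ns X :+ m) ∷ (xs X′ :≡ xs Y) ∷ (xs Z :≡ xs X :+ Ap) ∷ (loc X′ :+ (Ap :+ con 2) :≤ loc Z) ∷
          (cs Z :< con 3 :+ cs X′) ∷ [])
        refl A-y By≤Bx (D-shift x) A-x′ (#-shift 𝐱 x) long lt
      w : ℕ
      w = suc (x′ + m)
      w≤z : w ≤ z
      w≤z = ℕₚ.≮⇒≥ λ z<w → ℕₚ.<⇒≱ three (forward fx′ (ℕₚ.<⇒≤ z<w))
      found : ∃[ d ] w ≤ d × d < z × f d ≡ 𝐜 × B d ≡ B w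
      found = first 𝐜 z w≤z (ℕₚ.≤-trans (s≤s (forward fx′ ℕₚ.≤-refl)) three)
      d v : ℕ
      d = proj₁ found
      v = d ∸ m
      w≤d : w ≤ d
      w≤d = proj₁ (proj₂ found)
      d<z : d < z
      d<z = proj₁ (proj₂ (proj₂ found))
      fd : f d ≡ 𝐜
      fd = proj₁ (proj₂ (proj₂ (proj₂ found)))
      B-d : B d ≡ B w
      B-d = proj₂ (proj₂ (proj₂ (proj₂ found)))
      v+m≡d : v + m ≡ d
      v+m≡d = ℕₚ.m∸n+n≡m (ℕₚ.≤-trans (ℕₚ.m≤n⇒m≤1+n (ℕₚ.m≤n+m m x′)) w≤d)
      x′≤v : x′ ≤ v
      x′≤v = ℕₚ.m+n≤o⇒m≤o∸n x′ (ℕₚ.≤-trans (ℕₚ.n≤1+n _) w≤d)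

    -- Counts the 𝐧 of the period [u, q). Those in [u, y) and those between x′ and a later 𝐜
    -- together exceed m; the distances of the two 𝐜 from x and x′ decide the bounds.
    module Near (u≤x : u ≤ x) where
      B-cp : B (c + p) ≡ B q
      B-cp = trans (#-shift 𝐜 c) (trans (cong (_+ B p) B-u) (sym (#-shift 𝐜 u)))

      -- No 𝐜 stands in [q, c + p), the translate of [u, c), and z lies before c + p.
      before-q : ∀ {d} → f d ≡ 𝐜 → d < z → d < q
      before-q {d} fd d<z = ℕₚ.≰⇒> λ q≤d → ℕₚ.<⇒≱
        (ℕₚ.≤-trans (ℕₚ.≤-reflexive (sym (#-hit fd))) (#-mono 𝐜 (ℕₚ.≤-trans d<z (ℕₚ.+-monoˡ-≤ p (ℕₚ.<⇒≤ x<c)))))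
        (ℕₚ.≤-trans (ℕₚ.≤-reflexive B-cp) (#-mono 𝐜 q≤d))

      c<y : suc c ≤ y
      c<y = s≤s (ℕₚ.+-monoˡ-≤ m u≤x)

      three : B x′ + D x′ + 3 ≤ B z + D z
      three = ℕₚ.≮⇒≥ λ lt → timeline (x ∷ y ∷ x′ ∷ z ∷ []) (x≤y , y≤x′ , x′≤z , tt) (m ∷ A p ∷ [])
        (λ X Y X′ Z m Ap → (xs Y :≡ con 1 :+ xs X) ∷
          (xs X′ :≡ xs Y) ∷ (xs Z :≡ xs X :+ Ap) ∷ (loc X′ :+ (Ap :+ con 2) :≤ loc Z) ∷
          (cs Z :+ ns Z :< cs X′ :+ ns X′ :+ con 3) ∷ [])
        A-y A-x′ (#-shift 𝐱 x) long lt

      B-y : B y ≤ 2 + B x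
      B-y = forward fx ℕₚ.≤-refl

      A-c-u : A c ≤ 2 + A u
      A-c-u = backward fc ℕₚ.≤-refl

      -- [x, y) has at least m - 2 letters 𝐧, so the three letters of `three` cannot all be 𝐧.
      next-c : ∃[ d ] x′ ≤ d × d < z × f d ≡ 𝐜 × B d ≡ B x′
      next-c = first 𝐜 z x′≤z (ℕₚ.≰⇒> λ le → timeline (x ∷ y ∷ x′ ∷ z ∷ []) (x≤y , y≤x′ , x′≤z , tt) (m ∷ [])
        (λ X Y X′ Z m → (loc Y :≡ con 1 :+ (loc X :+ m)) ∷ (xs Y :≡ con 1 :+ xs X) ∷ (cs Y :≤ con 2 :+ cs X) ∷
          (ns Z :≡ ns X :+ m) ∷ (cs X′ :+ ns X′ :+ con 3 :≤ cs Z :+ ns Z) ∷ (cs Z :≤ cs X′) ∷ [])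
        refl A-y B-y (D-shift x) three le)

      d : ℕ
      d = proj₁ next-c
      x′≤d : x′ ≤ d
      x′≤d = proj₁ (proj₂ next-c)
      d<z : d < z
      d<z = proj₁ (proj₂ (proj₂ next-c))
      fd : f d ≡ 𝐜
      fd = proj₁ (proj₂ (proj₂ (proj₂ next-c)))
      B-d : B d ≡ B x′
      B-d = proj₂ (proj₂ (proj₂ (proj₂ next-c)))
      d<q : d < q
      d<q = before-q fd d<z
      x′<d : x′ < d
      x′<d = ℕₚ.≤∧≢⇒< x′≤d (apart fx′ fd)

      -- The m letters before c and the m letters before e contain no 𝐜 and at most two 𝐱 each, and
      -- 2 (m - 2) > m.
      beyond : ∀ {e} → f e ≡ 𝐜 → e < q → x′ + m < e → B e ≤ B x′ → ⊥
      beyond {e} fe e<q x′+m<e B-e = timeline (u ∷ x ∷ c ∷ suc c ∷ y ∷ x′ ∷ v ∷ e ∷ q ∷ [])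
        (u≤x , ℕₚ.<⇒≤ x<c , ℕₚ.n≤1+n c , c<y , y≤x′ , x′≤v , ℕₚ.m∸n≤m e m , ℕₚ.<⇒≤ e<q , tt) (m ∷ [])
        (λ U X C C+ Y X′ V E Q m → (loc C :≡ loc U :+ m) ∷ (loc C+ :≡ con 1 :+ loc C) ∷
          (loc Y :≡ con 1 :+ (loc X :+ m)) ∷ (xs C :≡ con 1 :+ xs X) ∷ (cs C :≡ cs X) ∷ (cs C :≡ cs U) ∷
          (xs Y :≡ con 1 :+ xs X) ∷ (xs C :≤ con 2 :+ xs U) ∷ (cs C+ :≡ con 1 :+ cs C) ∷
          (xs E :≤ con 2 :+ xs V) ∷ (cs E :≤ cs X′) ∷ (loc V :+ m :≡ loc E) ∷ (ns Q :≡ ns U :+ m) ∷ (con 5 :≤ m) ∷ [])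
        refl refl refl A-c B-c B-u A-y A-c-u (#-hit fc) (backward fe (ℕₚ.≤-reflexive (sym v+m≡e))) B-e v+m≡e
            (D-shift u) 5≤m
        where
        v = e ∸ m
        v+m≡e : v + m ≡ e
        v+m≡e = ℕₚ.m∸n+n≡m (ℕₚ.≤-trans (ℕₚ.m≤n+m m x′) (ℕₚ.<⇒≤ x′+m<e))
        x′≤v : x′ ≤ v
        x′≤v = ℕₚ.m+n≤o⇒m≤o∸n x′ (ℕₚ.<⇒≤ x′+m<e)

      -- An 𝐱 after x′ would precede d by less than h.
      no-x-before-h : d ≡ x′ + h → A d ≤ A (suc x′)
      no-x-before-h d≡ = none 𝐱 d λ j x′<j j<d fj →
        [ (λ eq → ℕₚ.<⇒≢ (ℕₚ.+-monoˡ-< h x′<j) (trans (sym d≡) eq))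
        , (λ eq → ℕₚ.<⇒≢ (ℕₚ.+-mono-< x′<j h<k) (trans (sym d≡) eq)) ]′
        (hole fj fd (ℕₚ.<⇒≤ j<d) (ℕₚ.≤-trans (ℕₚ.≤-reflexive d≡)
            (ℕₚ.+-mono-≤ (ℕₚ.<⇒≤ x′<j) (ℕₚ.≤-trans (ℕₚ.<⇒≤ h<k) k≤m))))

      -- Only e - h remains, because e - k is x′ itself.
      one-x-before : ∀ {e} → e ≡ x′ + k → f e ≡ 𝐜 → x′ ≤ e → e ≤ x′ + m → A e ≤ 1 + A (suc x′)
      one-x-before {e} e≡ fe x′≤e e≤ = one 𝐱 e (e ∸ h) λ j x′<j j<e fj →
        [ (λ eq → trans (sym (ℕₚ.m+n∸n≡m j h)) (cong (_∸ h) (sym eq)))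
        , (λ eq → ⊥-elim (ℕₚ.<⇒≢ (ℕₚ.+-monoˡ-< k x′<j) (trans (sym e≡) eq))) ]′
        (hole fj fe (ℕₚ.<⇒≤ j<e) (ℕₚ.≤-trans e≤ (ℕₚ.+-monoˡ-≤ m (ℕₚ.<⇒≤ x′<j))))

      one-x-before-k : d ≡ x′ + k → A d ≤ 1 + A (suc x′)
      one-x-before-k d≡ = one-x-before d≡ fd x′≤d (ℕₚ.≤-trans (ℕₚ.≤-reflexive d≡) (ℕₚ.+-monoʳ-≤ x′ k≤m))

      -- An 𝐱 before x would precede c by more than k.
      no-x-from-u : c ≡ x + k → A x ≤ A u
      no-x-from-u c≡ = none 𝐱 x λ j u≤j j<x fj →
        [ (λ eq → ℕₚ.<⇒≢ (ℕₚ.+-mono-< j<x h<k) (trans (sym eq) c≡))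
        , (λ eq → ℕₚ.<⇒≢ (ℕₚ.+-monoˡ-< k j<x) (trans (sym eq) c≡)) ]′
        (hole fj fc (ℕₚ.<⇒≤ (ℕₚ.<-trans j<x x<c)) (ℕₚ.+-monoˡ-≤ m u≤j))

      -- The larger distance k is already taken by c.
      no-c-after-k : c ≡ x + k → B y ≤ B (suc c)
      no-c-after-k c≡ = none 𝐜 y λ j c<j j<y fj →
        [ (λ eq → ℕₚ.<⇒≢ (ℕₚ.<-trans (ℕₚ.+-monoʳ-< x h<k) (subst (_< j) c≡ c<j)) (sym eq))
        , (λ eq → ℕₚ.<⇒≢ c<j (trans c≡ (sym eq))) ]′
        (hole fx fj (ℕₚ.<⇒≤ (ℕₚ.<-trans x<c c<j)) (ℕₚ.≤-pred j<y))

      -- At least 2 m - h - 3 letters 𝐧 lie in [u, y) and h - 1 between x′ and d, together 2 m - 4 >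
      -- m.
      both-h : c ≡ x + h → d ≡ x′ + h → ⊥
      both-h c≡ d≡ = timeline (u ∷ x ∷ c ∷ y ∷ x′ ∷ suc x′ ∷ d ∷ q ∷ [])
        (u≤x , ℕₚ.<⇒≤ x<c , ℕₚ.<⇒≤ c<y , y≤x′ , ℕₚ.n≤1+n x′ , x′<d , ℕₚ.<⇒≤ d<q , tt) (m ∷ h ∷ [])
        (λ U X C Y X′ X′+ E Q m h → (loc C :≡ loc U :+ m) ∷ (loc X′+ :≡ con 1 :+ loc X′) ∷
          (loc Y :≡ con 1 :+ (loc X :+ m)) ∷ (loc C :≡ loc X :+ h) ∷ (loc E :≡ loc X′ :+ h) ∷
          (xs C :≡ con 1 :+ xs X) ∷ (xs Y :≡ con 1 :+ xs X) ∷ (xs C :≤ con 2 :+ xs U) ∷ (cs Y :≤ con 2 :+ cs X) ∷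
          (cs C :≡ cs X) ∷ (cs C :≡ cs U) ∷ (xs E :≤ xs X′+) ∷ (cs E :≡ cs X′) ∷
          (ns Q :≡ ns U :+ m) ∷ (con 5 :≤ m) ∷ [])
        refl refl refl c≡ d≡ A-c A-y A-c-u B-y B-c B-u (no-x-before-h d≡) B-d (D-shift u) 5≤m

      -- Now [u, y) holds one 𝐱 and one 𝐜, hence 2 m - k - 1 letters 𝐧; at least k - 2 more lie
      -- between x′ and d.
      both-k : c ≡ x + k → d ≡ x′ + k → ⊥
      both-k c≡ d≡ = timeline (u ∷ x ∷ c ∷ suc c ∷ y ∷ x′ ∷ suc x′ ∷ d ∷ q ∷ [])
        (u≤x , ℕₚ.<⇒≤ x<c , ℕₚ.n≤1+n c , c<y , y≤x′ , ℕₚ.n≤1+n x′ , x′<d , ℕₚ.<⇒≤ d<q , tt) (m ∷ k ∷ [])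
        (λ U X C C+ Y X′ X′+ E Q m k → (loc C :≡ loc U :+ m) ∷ (loc X′+ :≡ con 1 :+ loc X′) ∷
          (loc Y :≡ con 1 :+ (loc X :+ m)) ∷ (loc C :≡ loc X :+ k) ∷ (loc E :≡ loc X′ :+ k) ∷
          (xs C :≡ con 1 :+ xs X) ∷ (xs Y :≡ con 1 :+ xs X) ∷ (xs X :≤ xs U) ∷
          (cs C+ :≡ con 1 :+ cs C) ∷ (cs Y :≤ cs C+) ∷
          (cs C :≡ cs X) ∷ (cs C :≡ cs U) ∷ (xs E :≤ con 1 :+ xs X′+) ∷ (cs E :≡ cs X′) ∷
          (ns Q :≡ ns U :+ m) ∷ (con 5 :≤ m) ∷ [])
        refl refl refl c≡ d≡ A-c A-y (no-x-from-u c≡) (#-hit fc) (no-c-after-k c≡) B-c B-u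
        (one-x-before-k d≡) B-d (D-shift u) 5≤m

      -- The count of `both-h`, with at least k - 2 ≥ h - 1 letters 𝐧 between x′ and d.
      h-then-k : c ≡ x + h → d ≡ x′ + k → ⊥
      h-then-k c≡ d≡ = timeline (u ∷ x ∷ c ∷ y ∷ x′ ∷ suc x′ ∷ d ∷ q ∷ [])
        (u≤x , ℕₚ.<⇒≤ x<c , ℕₚ.<⇒≤ c<y , y≤x′ , ℕₚ.n≤1+n x′ , x′<d , ℕₚ.<⇒≤ d<q , tt) (m ∷ h ∷ k ∷ [])
        (λ U X C Y X′ X′+ E Q m h k → (loc C :≡ loc U :+ m) ∷ (loc X′+ :≡ con 1 :+ loc X′) ∷
          (loc Y :≡ con 1 :+ (loc X :+ m)) ∷ (loc C :≡ loc X :+ h) ∷ (loc E :≡ loc X′ :+ k) ∷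
          (xs C :≡ con 1 :+ xs X) ∷ (xs Y :≡ con 1 :+ xs X) ∷ (xs C :≤ con 2 :+ xs U) ∷ (cs Y :≤ con 2 :+ cs X) ∷
          (cs C :≡ cs X) ∷ (cs C :≡ cs U) ∷ (xs E :≤ con 1 :+ xs X′+) ∷ (cs E :≡ cs X′) ∷ (ns Q :≡ ns U :+ m) ∷
          (con 5 :≤ m) ∷ (h :< k) ∷ [])
        refl refl refl c≡ d≡ A-c A-y A-c-u B-y B-c B-u (one-x-before-k d≡) B-d (D-shift u) 5≤m h<k

      -- The h - 1 letters 𝐧 before d need not suffice. But [x, y) holds m - 1 letters 𝐧, so `three`
      -- yields a second 𝐜 before z, at e, and the count is made up to e.
      k-then-h : c ≡ x + k → d ≡ x′ + h → ⊥
      k-then-h c≡ d≡ = second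
        where
        found : ∃[ e ] suc d ≤ e × e < z × f e ≡ 𝐜 × B e ≡ B (suc d)
        found = first 𝐜 z d<z (ℕₚ.≰⇒> λ le →
          timeline (x ∷ c ∷ suc c ∷ y ∷ x′ ∷ d ∷ suc d ∷ z ∷ [])
            (ℕₚ.<⇒≤ x<c , ℕₚ.n≤1+n c , c<y , y≤x′ , x′≤d , ℕₚ.n≤1+n d , d<z , tt) (m ∷ [])
            (λ X C C+ Y X′ E E+ Z m → (loc Y :≡ con 1 :+ (loc X :+ m)) ∷ (xs Y :≡ con 1 :+ xs X) ∷
              (cs C+ :≡ con 1 :+ cs C) ∷ (cs Y :≤ cs C+) ∷ (cs C :≡ cs X) ∷ (cs E :≡ cs X′) ∷
                  (cs E+ :≡ con 1 :+ cs E) ∷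
              (ns Z :≡ ns X :+ m) ∷ (cs X′ :+ ns X′ :+ con 3 :≤ cs Z :+ ns Z) ∷ (cs Z :≤ cs E+) ∷ [])
            refl A-y (#-hit fc) (no-c-after-k c≡) B-c B-d (#-hit fd) (D-shift x) three le)
        e : ℕ
        e = proj₁ found
        d<e : d < e
        d<e = proj₁ (proj₂ found)
        e<z : e < z
        e<z = proj₁ (proj₂ (proj₂ found))
        fe : f e ≡ 𝐜
        fe = proj₁ (proj₂ (proj₂ (proj₂ found)))
        B-e : B e ≡ suc (B x′)
        B-e = trans (proj₂ (proj₂ (proj₂ (proj₂ found)))) (trans (#-hit fd) (cong suc B-d))
        e<q : e < q
        e<q = before-q fe e<z

        far : x′ + m < e → ⊥
        far x′+m<e = timeline (u ∷ x ∷ c ∷ suc c ∷ y ∷ x′ ∷ v ∷ e ∷ q ∷ [])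
          (u≤x , ℕₚ.<⇒≤ x<c , ℕₚ.n≤1+n c , c<y , y≤x′ , x′≤v , ℕₚ.m∸n≤m e m , ℕₚ.<⇒≤ e<q , tt) (m ∷ k ∷ [])
          (λ U X C C+ Y X′ V E Q m k → (loc C :≡ loc U :+ m) ∷
            (loc Y :≡ con 1 :+ (loc X :+ m)) ∷ (loc C :≡ loc X :+ k) ∷
            (xs C :≡ con 1 :+ xs X) ∷ (xs Y :≡ con 1 :+ xs X) ∷ (xs X :≤ xs U) ∷
            (cs C+ :≡ con 1 :+ cs C) ∷ (cs Y :≤ cs C+) ∷ (cs C :≡ cs X) ∷ (cs C :≡ cs U) ∷
            (xs E :≤ con 2 :+ xs V) ∷ (cs E :≡ con 1 :+ cs X′) ∷ (loc V :+ m :≡ loc E) ∷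
            (ns Q :≡ ns U :+ m) ∷ (con 5 :≤ m) ∷ (k :≤ m) ∷ [])
          refl refl c≡ A-c A-y (no-x-from-u c≡) (#-hit fc) (no-c-after-k c≡) B-c B-u
          (backward fe (ℕₚ.≤-reflexive (sym v+m≡e))) B-e v+m≡e (D-shift u) 5≤m k≤m
          where
          v = e ∸ m
          v+m≡e : v + m ≡ e
          v+m≡e = ℕₚ.m∸n+n≡m (ℕₚ.≤-trans (ℕₚ.m≤n+m m x′) (ℕₚ.<⇒≤ x′+m<e))
          x′≤v : x′ ≤ v
          x′≤v = ℕₚ.m+n≤o⇒m≤o∸n x′ (ℕₚ.<⇒≤ x′+m<e)

        near : e ≡ x′ + k → e ≤ x′ + m → ⊥
        near e≡ e≤ = timeline (u ∷ x ∷ c ∷ suc c ∷ y ∷ x′ ∷ suc x′ ∷ e ∷ q ∷ [])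
          (u≤x , ℕₚ.<⇒≤ x<c , ℕₚ.n≤1+n c , c<y , y≤x′ , ℕₚ.n≤1+n x′ , ℕₚ.<-trans x′<d d<e , ℕₚ.<⇒≤ e<q , tt)
              (m ∷ k ∷ [])
          (λ U X C C+ Y X′ X′+ E Q m k → (loc C :≡ loc U :+ m) ∷ (loc X′+ :≡ con 1 :+ loc X′) ∷
            (loc Y :≡ con 1 :+ (loc X :+ m)) ∷ (loc C :≡ loc X :+ k) ∷ (loc E :≡ loc X′ :+ k) ∷
            (xs C :≡ con 1 :+ xs X) ∷ (xs Y :≡ con 1 :+ xs X) ∷ (xs X :≤ xs U) ∷
            (cs C+ :≡ con 1 :+ cs C) ∷ (cs Y :≤ cs C+) ∷
            (cs C :≡ cs X) ∷ (cs C :≡ cs U) ∷ (xs E :≤ con 1 :+ xs X′+) ∷ (cs E :≡ con 1 :+ cs X′) ∷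
            (ns Q :≡ ns U :+ m) ∷ (con 5 :≤ m) ∷ [])
          refl refl refl c≡ e≡ A-c A-y (no-x-from-u c≡) (#-hit fc) (no-c-after-k c≡) B-c B-u
          (one-x-before e≡ fe (ℕₚ.<⇒≤ (ℕₚ.<-trans x′<d d<e)) e≤) B-e (D-shift u) 5≤m

        second : ⊥
        second = [ (λ e≤ → [ (λ e≡ → ℕₚ.<⇒≢ d<e (trans d≡ (sym e≡))) , (λ e≡ → near e≡ e≤) ]′
                             (hole fx′ fe (ℕₚ.<⇒≤ (ℕₚ.<-trans x′<d d<e)) e≤))
                 , far ]′ (ℕₚ.≤-<-connex e (x′ + m))

      impossible : ⊥
      impossible = [ within , (λ d> → beyond fd d<q d> (ℕₚ.≤-reflexive B-d)) ]′ (ℕₚ.≤-<-connex d (x′ + m))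
        where
        within : d ≤ x′ + m → ⊥
        within d≤ = [ (λ c≡ → [ both-h c≡ , h-then-k c≡ ]′ (hole fx′ fd x′≤d d≤))
                    , (λ c≡ → [ k-then-h c≡ , both-k c≡ ]′ (hole fx′ fd x′≤d d≤)) ]′
                    (hole fx fc (ℕₚ.<⇒≤ x<c) (ℕₚ.+-monoˡ-≤ m u≤x))

    absurd : ⊥
    absurd = [ no-far , Near.impossible ]′ (ℕₚ.<-≤-connex x u)

-- Transitions with a long gap of 𝐜 only

≤ᵇ-true : ∀ {a b} → a ≤ b → (a ≤ᵇ b) ≡ true
≤ᵇ-true le = Equivalence.to T-≡ (ℕₚ.≤⇒≤ᵇ le)

≤ᵇ-false : ∀ {a b} → (a ≤ᵇ b) ≡ false → b < a
≤ᵇ-false eq = ℕₚ.≰⇒> λ le → subst T eq (ℕₚ.≤⇒≤ᵇ le)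

not-true : ∀ {a} → a ≡ false → not a ≡ true
not-true refl = refl

module LeftWide (cfg : Configuration) where
  open Core cfg

  module _ {u x : ℕ} (tr : Transition x (u + m)) (B-u : B (u + m) ≡ B u)
           (inner : suc (A x) < A (suc (x + m))) where
    open Transition tr
    c q : ℕ
    c = u + m
    q = u + p

    A-c-u : A c ≤ 2 + A u
    A-c-u = backward fc ℕₚ.≤-refl

    x<y : suc x ≤ suc (x + m)
    x<y = s≤s (ℕₚ.m≤m+n x m)

    u≤c : u ≤ c
    u≤c = ℕₚ.m≤m+n u m

    -- The next 𝐜 is more than m after z, so the m letters before it include at least m - 2 letters
    -- 𝐧, as do the m letters before c.
    no-triple : ∀ z → c ≤ z → f z ≡ 𝐱 → f (1 + z) ≡ 𝐱 → f (2 + z) ≡ 𝐱 → B (3 + z) < B q → ⊥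
    no-triple z c≤z f₀ f₁ f₂ lt = timeline (u ∷ c ∷ z ∷ v ∷ d ∷ q ∷ [])
      (u≤c , c≤z , z≤v , ℕₚ.m∸n≤m d m , ℕₚ.<⇒≤ d<q , tt) (m ∷ [])
      (λ U C Z V E Q m → (loc C :≡ loc U :+ m) ∷ (xs C :≤ con 2 :+ xs U) ∷ (cs C :≡ cs U) ∷
        (xs E :≤ con 2 :+ xs V) ∷ (cs E :≤ cs Z) ∷ (loc V :+ m :≡ loc E) ∷ (ns Q :≡ ns U :+ m) ∷ (con 5 :≤ m) ∷ [])
      refl A-c-u B-u (backward fd (ℕₚ.≤-reflexive (sym v+m≡d))) (ℕₚ.≤-trans (ℕₚ.≤-reflexive B-d) B-3) v+m≡d
          (D-shift u) 5≤m
      where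
      A-3 : A (3 + z) ≡ 3 + A z
      A-3 = trans (#-hit f₂) (cong suc (trans (#-hit f₁) (cong suc (#-hit f₀))))
      B-3 : B (3 + z) ≤ B z
      B-3 = ℕₚ.≮⇒≥ λ lt → timeline (z ∷ 3 + z ∷ []) (ℕₚ.m≤n+m z 3 , tt) []
        (λ Z Z+ → (loc Z+ :≡ con 3 :+ loc Z) ∷ (xs Z+ :≡ con 3 :+ xs Z) ∷ (cs Z :< cs Z+) ∷ []) refl A-3 lt
      found : ∃[ d ] 3 + z ≤ d × d < q × f d ≡ 𝐜 × B d ≡ B (3 + z)
      found = first 𝐜 q (ℕₚ.≮⇒≥ λ q< → ℕₚ.<⇒≱ lt (#-mono 𝐜 (ℕₚ.<⇒≤ q<))) lt
      d v : ℕ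
      d = proj₁ found
      v = d ∸ m
      d<q = proj₁ (proj₂ (proj₂ found))
      fd = proj₁ (proj₂ (proj₂ (proj₂ found)))
      B-d = proj₂ (proj₂ (proj₂ (proj₂ found)))
      z+m<d : z + m < d
      z+m<d = ℕₚ.≰⇒> λ d≤ → ℕₚ.<⇒≱ (subst (2 + A z <_) (sym A-3) ℕₚ.≤-refl)
        (ℕₚ.≤-trans (#-mono 𝐱 (proj₁ (proj₂ found))) (backward fd d≤))
      v+m≡d : v + m ≡ d
      v+m≡d = ℕₚ.m∸n+n≡m (ℕₚ.≤-trans (ℕₚ.m≤n+m m z) (ℕₚ.<⇒≤ z+m<d))
      z≤v : z ≤ v
      z≤v = ℕₚ.m+n≤o⇒m≤o∸n z (ℕₚ.<⇒≤ z+m<d)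

    -- Otherwise the last 𝐱 before the window is followed by m letters without 𝐱. If it is x, this
    -- contradicts `inner`; if it comes later, at least m - 2 of these letters are 𝐧, on top of the
    -- m - 2 before c.
    crowded : ∀ w → u ≤ w → w + m ≤ q → A w < A (w + m)
    crowded w u≤w w+m≤q = ℕₚ.≰⇒> λ le → [ (λ w≤x → ℕₚ.<⇒≱
        (ℕₚ.≤-trans (ℕₚ.≤-reflexive (sym (#-hit fx))) (#-mono 𝐱 (ℕₚ.≤-trans x<c (ℕₚ.+-monoˡ-≤ m u≤w))))
        (ℕₚ.≤-trans le (#-mono 𝐱 w≤x)))
      , empty le ]′ (ℕₚ.≤-<-connex w x)
      where
      module Empty (le : A (w + m) ≤ A w) (x<w : x < w) where
        found : ∃[ z ] x ≤ z × z < w × f z ≡ 𝐱 × A w ≡ suc (A z)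
        found = last 𝐱 w (ℕₚ.<⇒≤ x<w) (ℕₚ.≤-trans (ℕₚ.≤-reflexive (sym (#-hit fx))) (#-mono 𝐱 x<w))
        z : ℕ
        z = proj₁ found
        x≤z : x ≤ z
        x≤z = proj₁ (proj₂ found)
        z<w : z < w
        z<w = proj₁ (proj₂ (proj₂ found))
        fz = proj₁ (proj₂ (proj₂ (proj₂ found)))
        A-w : A w ≡ suc (A z)
        A-w = proj₂ (proj₂ (proj₂ (proj₂ found)))
        A-z : A (suc (z + m)) ≤ suc (A z)
        A-z = ℕₚ.≤-trans (#-mono 𝐱 (ℕₚ.+-monoˡ-≤ m z<w)) (ℕₚ.≤-trans le (ℕₚ.≤-reflexive A-w))
        same : z ≤ x → ⊥
        same z≤x = ℕₚ.<⇒≱ inner (subst (λ z → A (suc (z + m)) ≤ suc (A z)) (ℕₚ.≤-antisym z≤x x≤z) A-z)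
        c≤z : x < z → c ≤ z
        c≤z x<z = ℕₚ.≮⇒≥ λ z<c → constant 𝐱 (ℕₚ.≤-reflexive (trans A-c (sym (#-hit fx)))) x<z z<c fz
        later : x < z → ⊥
        later x<z = timeline (u ∷ c ∷ z ∷ suc (z + m) ∷ q ∷ [])
          (u≤c , c≤z x<z , ℕₚ.m≤n⇒m≤1+n (ℕₚ.m≤m+n z m) , ℕₚ.≤-trans (ℕₚ.+-monoˡ-≤ m z<w) w+m≤q , tt) (m ∷ [])
          (λ U C Z V Q m → (loc C :≡ loc U :+ m) ∷ (xs C :≤ con 2 :+ xs U) ∷ (cs C :≡ cs U) ∷
            (loc V :≡ con 1 :+ (loc Z :+ m)) ∷ (xs V :≤ con 1 :+ xs Z) ∷ (cs V :≤ con 2 :+ cs Z) ∷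
            (ns Q :≡ ns U :+ m) ∷ (con 5 :≤ m) ∷ [])
          refl A-c-u B-u refl A-z (forward fz ℕₚ.≤-refl) (D-shift u) 5≤m
      empty : A (w + m) ≤ A w → x < w → ⊥
      empty le x<w = [ Empty.same le x<w , Empty.later le x<w ]′ (ℕₚ.≤-<-connex (Empty.z le x<w) x)

    open Scan f u

    refuted : ∀ r → wideSearch m r h k ≡ true → ⊥
    refuted r = explore-sound allowed r 0
      where
      allowed : ∀ i → (5 ≤ᵇ tally 𝐜 (word i)) ≡ false → wide m h k (f (i + u)) (word i) ≡ true
      allowed i unfinished = ∧-true (≤ᵇ-true budget) (∧-true opening (∧-true (not-true thrice) (∧-true window
        (admissible-word i λ fc j fj j≤ ≤j → hole fj fc j≤ ≤j))))
        where
        -- Fewer than five 𝐜 have been read and a period has at least five, so the word has not left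
        -- the period that starts at u.
        short : B (i + u) < B q
        short = ℕₚ.≰⇒> λ le → linear 5
          (λ t Bi Bu Bp Bq → (t :< con 5) ∷ (t :+ Bu :≡ Bi) ∷ (Bq :≡ Bu :+ Bp) ∷ (con 5 :≤ Bp) ∷ (Bq :≤ Bi) ∷ [])
          (tally 𝐜 (word i) ∷ B (i + u) ∷ B u ∷ B p ∷ B q ∷ [])
          (≤ᵇ-false unfinished) (tally-word 𝐜 i) (#-shift 𝐜 u) 5≤B-p le
        1+i≤q : suc i + u ≤ q
        1+i≤q = ℕₚ.≰⇒> λ q≤ → ℕₚ.<⇒≱ short (#-mono 𝐜 q≤)
        budget : tally 𝐧 (word (suc i)) ≤ m
        budget = ℕₚ.+-cancelʳ-≤ (D u) _ m (ℕₚ.≤-trans (ℕₚ.≤-reflexive (tally-word 𝐧 (suc i)))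
          (ℕₚ.≤-trans (#-mono 𝐧 1+i≤q) (ℕₚ.≤-reflexive (trans (D-shift u) (ℕₚ.+-comm (D u) m)))))
        opening : opened m (f (i + u)) (word i) ≡ true
        opening rewrite length-word i with i <ᵇ m in lt | i ≡ᵇ m in eq
        ... | true | _ = not-true (is-false (constant 𝐜 (ℕₚ.≤-reflexive B-u) (ℕₚ.m≤n+m u i)
          (subst (i + u <_) (ℕₚ.+-comm m u) (ℕₚ.+-monoˡ-< u (ℕₚ.<ᵇ⇒< i m (subst T (sym lt) tt))))))
        ... | false | true rewrite ℕₚ.≡ᵇ⇒≡ i m (subst T (sym eq) tt) =
          trans (cong (is 𝐜) (trans (cong f (ℕₚ.+-comm m u)) fc)) refl
        ... | false | false = refl
        thrice : (m + 2 <ᵇ length (word i)) ∧ triple 𝐱 (f (i + u)) (word i) ≡ false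
        thrice rewrite length-word i with m + 2 <ᵇ i in lt
        ... | false = refl
        ... | true = triple-word 𝐱 i λ { j refl f₀ f₁ f₂ → no-triple (j + u)
          (subst (_≤ j + u) (ℕₚ.+-comm m u) (ℕₚ.+-monoˡ-≤ u
              (ℕₚ.<⇒≤ (m<j j (ℕₚ.<ᵇ⇒< (m + 2) (2 + j) (subst T (sym lt) tt))))))
          f₀ f₁ f₂ (subst (_< B q) (sym (#-skip f₂)) short) }
          where
          m<j : ∀ j → m + 2 < 2 + j → m < j
          m<j j le = ℕₚ.+-cancelˡ-< 2 m j (subst (_< 2 + j) (ℕₚ.+-comm m 2) le)
        window : (suc (length (word i)) <ᵇ m) ∨ any (is 𝐱) (take m (word (suc i))) ≡ true
        window = subst (λ n → (suc n <ᵇ m) ∨ any (is 𝐱) (take m (word (suc i))) ≡ true) (sym (length-word i))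
          (window-word m (suc i) λ j eq → subst (λ n → A (j + u) < A n) (place j eq)
            (crowded (j + u) (ℕₚ.m≤n+m u j) (subst (_≤ q) (sym (place j eq)) 1+i≤q)))
          where
          place : ∀ j → m + j ≡ suc i → j + u + m ≡ suc i + u
          place j eq = trans (ℕₚ.+-comm (j + u) m) (trans (sym (ℕₚ.+-assoc m j u)) (cong (_+ u) eq))

    small : pairs m (wideSearch m 33) ≡ true → ⊥
    small ok = refuted 33 (pairs-sound m (wideSearch m 33) ok 1≤h h<k k≤m)

    -- At most four 𝐜 stand between u and w, so another one follows before q. The m letters before
    -- it include at least m - 4 letters 𝐧, those before c at least m - 2.
    large : 7 ≤ m → ⊥
    large 7≤m = timeline (u ∷ c ∷ x′ ∷ v ∷ d ∷ q ∷ [])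
      (u≤c , c≤x′ , x′≤v , ℕₚ.m∸n≤m d m , ℕₚ.<⇒≤ d<q , tt) (m ∷ [])
      (λ U C X′ V E Q m → (loc C :≡ loc U :+ m) ∷ (xs C :≤ con 2 :+ xs U) ∷ (cs C :≡ cs U) ∷
        (xs E :≤ con 2 :+ xs V) ∷ (cs E :≤ con 2 :+ cs X′) ∷ (loc V :+ m :≡ loc E) ∷ (ns Q :≡ ns U :+ m) ∷
            (con 7 :≤ m) ∷ [])
      refl A-c-u B-u (backward fd (ℕₚ.≤-reflexive (sym v+m≡d)))
      (ℕₚ.≤-trans (ℕₚ.≤-reflexive B-d) (forward fx′ ℕₚ.≤-refl)) v+m≡d (D-shift u) 7≤m
      where
      next-x : ∃[ x′ ] suc x ≤ x′ × x′ < suc (x + m) × f x′ ≡ 𝐱 × A x′ ≡ A (suc x)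
      next-x = first 𝐱 (suc (x + m)) x<y (subst (_< A (suc (x + m))) (sym (#-hit fx)) inner)
      x′ w : ℕ
      x′ = proj₁ next-x
      w = suc (x′ + m)
      fx′ : f x′ ≡ 𝐱
      fx′ = proj₁ (proj₂ (proj₂ (proj₂ next-x)))
      c≤x′ : c ≤ x′
      c≤x′ = ℕₚ.≮⇒≥ λ x′<c → constant 𝐱 (ℕₚ.≤-reflexive (trans A-c (sym (#-hit fx)))) (proj₁ (proj₂ next-x)) x′<c fx′
      five : 5 + B u ≤ B q
      five = subst (5 + B u ≤_) (sym (trans (#-shift 𝐜 u) (ℕₚ.+-comm (B u) (B p)))) (ℕₚ.+-monoˡ-≤ (B u) 5≤B-p)
      four : ∀ y → y ≤ w → B y < 5 + B u
      four y y≤w = s≤s (ℕₚ.≤-trans (forward fx′ y≤w) (ℕₚ.+-monoʳ-≤ 2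
        (ℕₚ.≤-trans (forward fx (ℕₚ.<⇒≤ (proj₁ (proj₂ (proj₂ next-x)))))
            (ℕₚ.+-monoʳ-≤ 2 (ℕₚ.≤-reflexive (trans (sym B-c) B-u))))))
      found : ∃[ d ] w ≤ d × d < q × f d ≡ 𝐜 × B d ≡ B w
      found = first 𝐜 q (ℕₚ.≮⇒≥ λ q<w → ℕₚ.<⇒≱ (four q (ℕₚ.<⇒≤ q<w)) five) (ℕₚ.<-≤-trans (four w ℕₚ.≤-refl) five)
      d v : ℕ
      d = proj₁ found
      v = d ∸ m
      d<q = proj₁ (proj₂ (proj₂ found))
      fd = proj₁ (proj₂ (proj₂ (proj₂ found)))
      B-d = proj₂ (proj₂ (proj₂ (proj₂ found)))
      x′+m≤d : x′ + m ≤ d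
      x′+m≤d = ℕₚ.<⇒≤ (proj₁ (proj₂ found))
      v+m≡d : v + m ≡ d
      v+m≡d = ℕₚ.m∸n+n≡m (ℕₚ.≤-trans (ℕₚ.m≤n+m m x′) x′+m≤d)
      x′≤v : x′ ≤ v
      x′≤v = ℕₚ.m+n≤o⇒m≤o∸n x′ x′+m≤d

-- Words without long gaps at transitions

module NarrowCase (cfg : Configuration) where
  open Core cfg

  -- Writing the 𝐜 as `u + m` restricts to transitions preceded by m letters. Hence positions below
  -- are moved on by periods before this is applied.
  Narrow : Set
  Narrow = ∀ {u x} → Transition x (u + m) → suc (A x) < A (suc (x + m)) × B u < B (u + m)

  within-period : ∀ l s → 5 ≤ # l p → # l s < # l (s + p)
  within-period l s 5≤ = subst (# l s <_) (sym (#-shift l s)) (ℕₚ.m<m+n (# l s) (ℕₚ.≤-trans (s≤s z≤n) 5≤))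

  module _ (narrow : Narrow) where

    narrow-x : ∀ {x c} → Transition x c → m ≤ c → suc (A x) < A (suc (x + m))
    narrow-x {x} tr m≤c = proj₁ (narrow (subst (Transition x) (sym (ℕₚ.m∸n+n≡m m≤c)) tr))

    narrow-c : ∀ {x c} → Transition x c → ∀ v → v + m ≡ c → B v < B c
    narrow-c tr v refl = proj₂ (narrow tr)

    transition-before : ∀ {s c} → s ≤ c → f c ≡ 𝐜 → A s < A c → B c ≤ B s → ∃[ x ] Transition x c
    transition-before {s} {c} s≤c fc lt le =
      let x , s≤x , x<c , fx , A-c = last 𝐱 c s≤c lt in
      x , record { x<c = x<c ; fx = fx ; fc = fc ; A-c = A-c
                 ; B-c = ℕₚ.≤-antisym (ℕₚ.≤-trans le (#-mono 𝐜 s≤x)) (#-mono 𝐜 (ℕₚ.<⇒≤ x<c)) }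

    -- The first 𝐜 after the last 𝐱 completes a transition. Starting at s + p leaves a whole period
    -- beyond s to find that 𝐱.
    previous-x : ∀ s → m ≤ s → f (s + p) ≡ 𝐜 →
      ∃[ x ] x < s + p × f x ≡ 𝐱 × A (s + p) ≡ suc (A x) × suc (A x) < A (suc (x + m))
    previous-x s m≤s fz =
      let x , s≤x , x<z , fx , A-z = last 𝐱 (s + p) (ℕₚ.m≤m+n s p) (within-period 𝐱 s 5≤A-p)
          d , x≤d , d<1+z , fd , B-d = first 𝐜 (suc (s + p)) (ℕₚ.m≤n⇒m≤1+n (ℕₚ.<⇒≤ x<z))
                                 (subst (B x <_) (sym (#-hit fz)) (s≤s (#-mono 𝐜 (ℕₚ.<⇒≤ x<z))))
          x<d = ℕₚ.≤∧≢⇒< x≤d (apart fx fd)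
          A-d = ℕₚ.≤-antisym (ℕₚ.≤-trans (#-mono 𝐱 (ℕₚ.≤-pred d<1+z)) (ℕₚ.≤-reflexive A-z))
                  (ℕₚ.≤-trans (ℕₚ.≤-reflexive (sym (#-hit fx))) (#-mono 𝐱 x<d))
      in x , x<z , fx , A-z , narrow-x (record { x<c = x<d ; fx = fx ; fc = fd ; A-c = A-d ; B-c = B-d })
           (ℕₚ.≤-trans m≤s (ℕₚ.≤-trans s≤x x≤d))

    -- The next 𝐜 is more than m after z, so the m letters before it contain no 𝐜.
    no-triple-x : ∀ z → f z ≡ 𝐱 → f (1 + z) ≡ 𝐱 → f (2 + z) ≡ 𝐱 → ⊥
    no-triple-x z f₀ f₁ f₂ = ℕₚ.<⇒≱ (narrow-c tr v v+m≡d) (ℕₚ.≤-trans B-d≤ (#-mono 𝐜 z≤v))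
      where
      A-3 : A (3 + z) ≡ 3 + A z
      A-3 = trans (#-hit f₂) (cong suc (trans (#-hit f₁) (cong suc (#-hit f₀))))
      found : ∃[ d ] 3 + z ≤ d × d < 3 + z + p × f d ≡ 𝐜 × B d ≡ B (3 + z)
      found = first 𝐜 (3 + z + p) (ℕₚ.m≤m+n (3 + z) p) (within-period 𝐜 (3 + z) 5≤B-p)
      d v : ℕ
      d = proj₁ found
      v = d ∸ m
      fd = proj₁ (proj₂ (proj₂ (proj₂ found)))
      B-d≤ : B d ≤ B z
      B-d≤ = ℕₚ.≤-reflexive (trans (proj₂ (proj₂ (proj₂ (proj₂ found))))
          (trans (#-skip f₂) (trans (#-skip f₁) (#-skip f₀))))
      A-d : 3 + A z ≤ A d
      A-d = subst (_≤ A d) A-3 (#-mono 𝐱 (proj₁ (proj₂ found)))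
      z+m<d : z + m < d
      z+m<d = ℕₚ.≰⇒> λ d≤ → ℕₚ.<⇒≱ A-d (backward fd d≤)
      v+m≡d : v + m ≡ d
      v+m≡d = ℕₚ.m∸n+n≡m (ℕₚ.≤-trans (ℕₚ.m≤n+m m z) (ℕₚ.<⇒≤ z+m<d))
      z≤v : z ≤ v
      z≤v = ℕₚ.m+n≤o⇒m≤o∸n z (ℕₚ.<⇒≤ z+m<d)
      tr : Transition _ d
      tr = proj₂ (transition-before (ℕₚ.≤-trans (ℕₚ.m≤n+m z 3) (proj₁ (proj₂ found))) fd
          (ℕₚ.≤-trans (s≤s (ℕₚ.m≤n+m (A z) 2)) A-d) B-d≤)

    -- Not all three 𝐜 lie within distance m of the previous 𝐱, so the m letters after that 𝐱
    -- contain no 𝐱.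
    no-triple-c : ∀ s → m ≤ s → f (s + p) ≡ 𝐜 → f (1 + (s + p)) ≡ 𝐜 → f (2 + (s + p)) ≡ 𝐜 → ⊥
    no-triple-c s m≤s f₀ f₁ f₂ =
      let x , x<z , fx , A-z , inner = previous-x s m≤s f₀ in
      ℕₚ.<⇒≱ inner (ℕₚ.≤-trans (#-mono 𝐱 {j = 2 + z} (ℕₚ.≰⇒> λ le → ℕₚ.<⇒≱ (B-3 x x<z) (forward fx (s≤s le))))
        (ℕₚ.≤-reflexive (trans (#-skip-c f₁) (trans (#-skip-c f₀) A-z))))
      where
      z = s + p
      B-3 : ∀ x → x < z → 3 + B x ≤ B (3 + z)
      B-3 x x<z = subst (3 + B x ≤_) (sym (trans (#-hit f₂) (cong suc (trans (#-hit f₁) (cong suc (#-hit f₀))))))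
        (s≤s (s≤s (s≤s (#-mono 𝐜 (ℕₚ.<⇒≤ x<z)))))

    -- 33 D t - m t ≤ 33 D s - m s, with the subtractions moved across.
    Highest : ℕ → ℕ → Set
    Highest s t = 33 * D t + m * s ≤ 33 * D s + m * t

    highest : ∀ b n → ∃[ s ] b ≤ s × (∀ r → r ≤ n → Highest s (r + b))
    highest b zero = b , ℕₚ.≤-refl , λ { zero _ → ℕₚ.≤-refl }
    highest b (suc n) with highest b n
    ... | s , b≤s , best with ℕₚ.≤-total (33 * D (suc n + b) + m * s) (33 * D s + m * (suc n + b))
    ...   | inj₁ le = s , b≤s , λ r r≤ → [ (λ r<1+n → best r (ℕₚ.≤-pred r<1+n)) , (λ { refl → le }) ]′
        (ℕₚ.m≤n⇒m<n∨m≡n r≤)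
    ...   | inj₂ ge = suc n + b , ℕₚ.m≤n+m b (suc n) , λ r r≤ →
      [ (λ r<1+n → better r (best r (ℕₚ.≤-pred r<1+n))) , (λ { refl → ℕₚ.≤-refl }) ]′ (ℕₚ.m≤n⇒m<n∨m≡n r≤)
      where
      better : ∀ r → Highest s (r + b) → Highest (suc n + b) (r + b)
      better r le = ℕₚ.≮⇒≥ λ lt → linear 6
        (λ Dt Ds Dr mt ms mr → (33 :* Dr :+ ms :≤ 33 :* Ds :+ mr) ∷ (33 :* Ds :+ mt :≤ 33 :* Dt :+ ms) ∷
          (33 :* Dt :+ mr :< 33 :* Dr :+ mt) ∷ [])
        (D (suc n + b) ∷ D s ∷ D (r + b) ∷ m * (suc n + b) ∷ m * s ∷ m * (r + b) ∷ []) le ge lt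

    -- Over a period 33 D grows by 33 m ≤ m p, so a maximum over one period is never exceeded later.
    highest-everywhere : ∀ b → ∃[ s ] b ≤ s × (∀ i → 33 * tally 𝐧 (Scan.word f s i) ≤ m * i)
    highest-everywhere b with highest b p
    ... | s , b≤s , best = s , b≤s , λ i → ℕₚ.≮⇒≥ λ lt → linear 7
      (λ Dt Ds t ms mi mis tal → (33 :* Dt :+ ms :≤ 33 :* Ds :+ mis) ∷ (mis :≡ mi :+ ms) ∷ (tal :+ Ds :≡ Dt) ∷
          (mi :< 33 :* tal) ∷ [])
      (D (i + s) ∷ D s ∷ i ∷ m * s ∷ m * i ∷ m * (i + s) ∷ tally 𝐧 (Scan.word f s i) ∷ [])
      (all-best i) (ℕₚ.*-distribˡ-+ m i s) (Scan.tally-word f s 𝐧 i) lt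
      where
      instance
        p≢0 : NonZero p
        p≢0 = ℕ.>-nonZero (ℕₚ.≤-trans (s≤s z≤n) 32<p)
      shifted : ∀ n r → r ≤ p → Highest s (r + b + n * p)
      shifted zero r r≤ = subst (Highest s) (sym (ℕₚ.+-identityʳ (r + b))) (best r r≤)
      shifted (suc n) r r≤ = subst (Highest s) (place (r + b) (n * p)) (ℕₚ.≮⇒≥ λ lt → linear 7
        (λ Dt Dt′ Ds ms mt mt′ mp → (33 :* Dt :+ ms :≤ 33 :* Ds :+ mt) ∷ (mt′ :≡ mt :+ mp) ∷
            (33 :* Dt′ :≤ 33 :* Dt :+ mp) ∷
          (33 :* Ds :+ mt′ :< 33 :* Dt′ :+ ms) ∷ [])
        (D (r + b + n * p) ∷ D (r + b + n * p + p) ∷ D s ∷ m * s ∷ m * (r + b + n * p) ∷ m * (r + b + n * p + p) ∷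
          m * p ∷ [])
        (shifted n r r≤) (ℕₚ.*-distribˡ-+ m (r + b + n * p) p) growth lt)
        where
        place : ∀ a c → a + c + p ≡ a + (p + c)
        place a c = trans (ℕₚ.+-assoc a c p) (cong (a +_) (ℕₚ.+-comm c p))
        growth : 33 * D (r + b + n * p + p) ≤ 33 * D (r + b + n * p) + m * p
        growth = ℕₚ.≤-trans (ℕₚ.*-monoʳ-≤ 33 (ℕₚ.≤-reflexive (D-shift (r + b + n * p))))
          (ℕₚ.≤-trans (ℕₚ.≤-reflexive (ℕₚ.*-distribˡ-+ 33 (D (r + b + n * p)) m))
          (ℕₚ.+-monoʳ-≤ (33 * D (r + b + n * p)) (ℕₚ.≤-trans (ℕₚ.*-monoˡ-≤ m 32<p) (ℕₚ.≤-reflexive (ℕₚ.*-comm p m)))))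
      all-best : ∀ i → Highest s (i + s)
      all-best i = subst (Highest s) place (shifted (j / p) (j % p) (ℕₚ.<⇒≤ (m%n<n j p)))
        where
        j = i + (s ∸ b)
        place : j % p + b + j / p * p ≡ i + s
        place = trans (swap (j % p) b (j / p * p)) (trans (cong (_+ b) (sym (m≡m%n+[m/n]*n j p)))
          (trans (ℕₚ.+-assoc i (s ∸ b) b) (cong (i +_) (ℕₚ.m∸n+n≡m b≤s))))
          where
          swap : ∀ a b c → a + b + c ≡ a + c + b
          swap a b c = trans (ℕₚ.+-assoc a b c) (trans (cong (a +_) (ℕₚ.+-comm b c)) (sym (ℕₚ.+-assoc a c b)))

    few : ∀ r → steepSearch m r h k ≡ true → ⊥
    few r = explore-sound allowed r 0
      where
      -- Beyond m + p there is room for the step back by a period that `no-triple-c` requires.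
      top : ∃[ s ] m + p ≤ s × (∀ i → 33 * tally 𝐧 (Scan.word f s i) ≤ m * i)
      top = highest-everywhere (m + p)
      s s′ : ℕ
      s = proj₁ top
      s′ = s ∸ p
      s′+p≡s : s′ + p ≡ s
      s′+p≡s = ℕₚ.m∸n+n≡m (ℕₚ.≤-trans (ℕₚ.m≤n+m p m) (proj₁ (proj₂ top)))
      m≤s′ : m ≤ s′
      m≤s′ = ℕₚ.m+n≤o⇒m≤o∸n m (proj₁ (proj₂ top))
      open Scan f s
      shift-back : ∀ j → (j + s′) + p ≡ j + s
      shift-back j = trans (ℕₚ.+-assoc j s′ p) (cong (j +_) s′+p≡s)
      allowed : ∀ i → false ≡ false → steep m h k (f (i + s)) (word i) ≡ true
      allowed i _ = ∧-true (≤ᵇ-true (subst (λ n → 33 * tally 𝐧 (word (suc i)) ≤ m * suc n) (sym (length-word i))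
          (proj₂ (proj₂ top) (suc i))))
        (∧-true (not-true (triple-word 𝐱 i λ { j refl f₀ f₁ f₂ → no-triple-x (j + s) f₀ f₁ f₂ }))
        (∧-true (not-true (triple-word 𝐜 i λ { j refl f₀ f₁ f₂ → no-triple-c (j + s′)
            (ℕₚ.≤-trans m≤s′ (ℕₚ.m≤n+m s′ j))
            (trans (cong f (shift-back j)) f₀) (trans (cong (λ i → f (1 + i)) (shift-back j)) f₁)
            (trans (cong (λ i → f (2 + i)) (shift-back j)) f₂) }))
        (admissible-word i λ fc j fj j≤ ≤j → hole fj fc j≤ ≤j)))

    -- By the bounds at v, at least m - 4 of the m letters before c are 𝐧; by those at b, at most
    -- eight other letters are passed.
    record Step (b v c : ℕ) : Set where
      field
        b≤v  : b ≤ v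
        v+m  : v + m ≡ c
        fc   : f c ≡ 𝐜
        A-b  : A c ≤ 4 + A b
        B-b  : B c ≤ 4 + B b
        A-v  : A c ≤ 2 + A v
        B-v  : B c ≤ 2 + B v

    step : ∀ s → m ≤ s → f (s + p) ≡ 𝐜 → ∃[ v ] ∃[ c ] Step (s + p) v c
    step s m≤s fb = v , c , record
      { b≤v = ℕₚ.≤-trans b≤y y≤v ; v+m = v+m≡c ; fc = fc ; A-v = backward fc (ℕₚ.≤-reflexive (sym v+m≡c))
      ; B-v = ℕₚ.≤-trans B-c (ℕₚ.+-monoʳ-≤ 2 (#-mono 𝐜 y≤v))
      ; B-b = ℕₚ.≤-trans B-c (ℕₚ.+-monoʳ-≤ 2 B-y)
      ; A-b = ℕₚ.≤-trans A-c (ℕₚ.+-monoʳ-≤ 2 A-e) }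
      where
      b : ℕ
      b = s + p
      next-x : ∃[ y ] b ≤ y × y < b + p × f y ≡ 𝐱 × A y ≡ A b
      next-x = first 𝐱 (b + p) (ℕₚ.m≤m+n b p) (within-period 𝐱 b 5≤A-p)
      y : ℕ
      y = proj₁ next-x
      b≤y : b ≤ y
      b≤y = proj₁ (proj₂ next-x)
      fy = proj₁ (proj₂ (proj₂ (proj₂ next-x)))
      A-y : A y ≡ A b
      A-y = proj₂ (proj₂ (proj₂ (proj₂ next-x)))
      -- The previous 𝐱 has another 𝐱 within distance m, and the next one is y; so `forward` reaches
      -- y.
      B-y : B y ≤ 2 + B b
      B-y = let x , x<b , fx , A-b , inner = previous-x s m≤s fb in
        ℕₚ.≤-trans (forward {y = y} fx (ℕₚ.≮⇒≥ λ lt → ℕₚ.<⇒≱ inner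
            (ℕₚ.≤-trans (#-mono 𝐱 (ℕₚ.<⇒≤ lt)) (ℕₚ.≤-reflexive (trans A-y A-b)))))
          (ℕₚ.+-monoʳ-≤ 2 (#-mono 𝐜 (ℕₚ.<⇒≤ x<b)))
      w : ℕ
      w = suc (y + m)
      next-c : ∃[ c ] w ≤ c × c < w + p × f c ≡ 𝐜 × B c ≡ B w
      next-c = first 𝐜 (w + p) (ℕₚ.m≤m+n w p) (within-period 𝐜 w 5≤B-p)
      c v : ℕ
      c = proj₁ next-c
      v = c ∸ m
      w≤c : w ≤ c
      w≤c = proj₁ (proj₂ next-c)
      fc : f c ≡ 𝐜
      fc = proj₁ (proj₂ (proj₂ (proj₂ next-c)))
      B-c : B c ≤ 2 + B y
      B-c = ℕₚ.≤-trans (ℕₚ.≤-reflexive (proj₂ (proj₂ (proj₂ (proj₂ next-c))))) (forward fy ℕₚ.≤-refl)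
      v+m≡c : v + m ≡ c
      v+m≡c = ℕₚ.m∸n+n≡m (ℕₚ.≤-trans (ℕₚ.m≤n+m m y) (ℕₚ.<⇒≤ w≤c))
      y≤v : y ≤ v
      y≤v = ℕₚ.m+n≤o⇒m≤o∸n y (ℕₚ.<⇒≤ w≤c)
      b<c : b < c
      b<c = ℕₚ.≤-trans (s≤s (ℕₚ.≤-trans b≤y (ℕₚ.m≤m+n y m))) w≤c
      last-c : ∃[ e ] b ≤ e × e < c × f e ≡ 𝐜 × B c ≡ suc (B e)
      last-c = last 𝐜 c (ℕₚ.<⇒≤ b<c) (ℕₚ.≤-trans (ℕₚ.≤-reflexive (sym (#-hit fb))) (#-mono 𝐜 b<c))
      e : ℕ
      e = proj₁ last-c
      fe = proj₁ (proj₂ (proj₂ (proj₂ last-c)))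
      B-e : B c ≡ suc (B e)
      B-e = proj₂ (proj₂ (proj₂ (proj₂ last-c)))
      e≤y+m : e ≤ y + m
      e≤y+m = ℕₚ.≤-pred (ℕₚ.≰⇒> λ w≤e → ℕₚ.<⇒≱ {B e} (ℕₚ.≤-reflexive (sym B-e))
        (ℕₚ.≤-trans (ℕₚ.≤-reflexive (proj₂ (proj₂ (proj₂ (proj₂ next-c))))) (#-mono 𝐜 w≤e)))
      A-e : A e ≤ 2 + A b
      A-e = ℕₚ.≤-trans (backward fe e≤y+m) (ℕₚ.+-monoʳ-≤ 2 (ℕₚ.≤-reflexive A-y))
      -- If an 𝐱 stands between e and c, a transition ends at c. Narrowness then puts e among the m
      -- letters before c.
      A-c : A c ≤ 2 + A e
      A-c = [ (λ le → ℕₚ.≤-trans le (ℕₚ.m≤n+m (A e) 2)) , recent ]′ (ℕₚ.≤-<-connex (A c) (A e))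
        where
        recent : A e < A c → A c ≤ 2 + A e
        recent lt = ℕₚ.≤-trans (backward fc (ℕₚ.≤-reflexive (sym v+m≡c))) (ℕₚ.+-monoʳ-≤ 2 (#-mono 𝐱 v≤e))
          where
          tr = proj₂ (transition-before {suc e} (proj₁ (proj₂ (proj₂ last-c))) fc
                 (subst (_< A c) (sym (#-skip-c fe)) lt) (ℕₚ.≤-reflexive (trans B-e (sym (#-hit fe)))))
          v≤e : v ≤ e
          v≤e = ℕₚ.≮⇒≥ λ e<v → ℕₚ.<⇒≱ (narrow-c tr v v+m≡c)
            (ℕₚ.≤-trans (ℕₚ.≤-reflexive (trans B-e (sym (#-hit fe)))) (#-mono 𝐜 e<v))

    -- From x + m + 1 to x + p there are at least B p - 2 letters 𝐜, and likewise for y. The two intervals would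
    -- be disjoint modulo p, although 2 (B p - 2) > B p.
    not-apart : ∀ {x y} → f x ≡ 𝐱 → f y ≡ 𝐱 → x + p ≤ y + suc m → y ≤ x + suc m → ⊥
    not-apart {x} {y} fx fy le₁ le₂ = timeline (x + suc m ∷ x + p ∷ y + suc m ∷ y + p ∷ x + suc m + p ∷ [])
      (ℕₚ.+-monoʳ-≤ x m<p , le₁ , ℕₚ.+-monoʳ-≤ y m<p , ℕₚ.+-monoˡ-≤ p le₂ , tt) (B x ∷ B y ∷ B p ∷ [])
      (λ X X+ Y Y+ Z Bx By Bp → (cs X :≤ con 2 :+ Bx) ∷ (cs X+ :≡ Bx :+ Bp) ∷ (cs Y :≤ con 2 :+ By) ∷
        (cs Y+ :≡ By :+ Bp) ∷ (cs Z :≡ cs X :+ Bp) ∷ (con 5 :≤ Bp) ∷ [])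
      (forward fx (ℕₚ.≤-reflexive (ℕₚ.+-suc x m))) (#-shift 𝐜 x) (forward fy (ℕₚ.≤-reflexive (ℕₚ.+-suc y m)))
      (#-shift 𝐜 y) (#-shift 𝐜 (x + suc m)) 5≤B-p

    p≡ : A p + B p + m ≡ p
    p≡ = trans (cong (A p + B p +_) (sym D-p)) (total p)

    -- Now p ≤ m + 12. By `not-apart` some 𝐱, at z, is followed by m + 1 letters without 𝐱. Then
    -- either a transition starts at z that is not narrow, or the period has more than m letters 𝐧.
    crowded-x : A p ≤ 6 → B p ≤ 6 → ⊥
    crowded-x A-p B-p = [ near , far ]′ (ℕₚ.≤-<-connex c (z + suc m))
      where
      11+m≤p : 11 + m ≤ suc p
      11+m≤p = ℕₚ.≮⇒≥ λ lt → linear 4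
        (λ m p a b → (con 5 :≤ a) ∷ (con 5 :≤ b) ∷ (a :+ b :+ m :≡ p) ∷ (con 1 :+ p :< con 11 :+ m) ∷ [])
        (m ∷ p ∷ A p ∷ B p ∷ []) 5≤A-p 5≤B-p p≡ lt
      next-x : ∃[ x ] m ≤ x × x < m + p × f x ≡ 𝐱 × A x ≡ A m
      next-x = first 𝐱 (m + p) (ℕₚ.m≤m+n m p) (within-period 𝐱 m 5≤A-p)
      x g e : ℕ
      x = proj₁ next-x
      g = p ∸ suc m
      -- This lies m + 1 positions before the next copy of x.
      e = x + g
      m≤x : m ≤ x
      m≤x = proj₁ (proj₂ next-x)
      fx = proj₁ (proj₂ (proj₂ (proj₂ next-x)))
      e+n : e + suc m ≡ x + p
      e+n = trans (ℕₚ.+-assoc x g (suc m)) (cong (x +_) (ℕₚ.m∸n+n≡m m<p))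
      x<e : x < e
      x<e = ℕₚ.m<m+n x (ℕₚ.m<n⇒0<n∸m (ℕₚ.≤-pred (ℕₚ.≤-trans (ℕₚ.+-monoˡ-≤ m (s≤s (s≤s (s≤s z≤n)))) 11+m≤p)))
      last-x : ∃[ z ] x ≤ z × z < e × f z ≡ 𝐱 × A e ≡ suc (A z)
      last-x = last 𝐱 e (ℕₚ.<⇒≤ x<e) (ℕₚ.≤-trans (ℕₚ.≤-reflexive (sym (#-hit fx))) (#-mono 𝐱 x<e))
      z : ℕ
      z = proj₁ last-x
      z<e : z < e
      z<e = proj₁ (proj₂ (proj₂ last-x))
      fz = proj₁ (proj₂ (proj₂ (proj₂ last-x)))
      A-e : A e ≡ suc (A z)
      A-e = proj₂ (proj₂ (proj₂ (proj₂ last-x)))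
      -- From p ≤ m + 12 and p > 32 follows 2 p ≤ 3 m + 5.
      wrapped : ∀ {j} → x + suc m < j → z + p ≤ j + suc m
      wrapped {j} lt = ℕₚ.≮⇒≥ λ lt′ → linear 8
        (λ x m e p z j a b → (x :+ (con 1 :+ m) :< j) ∷ (e :+ (con 1 :+ m) :≡ x :+ p) ∷ (z :< e) ∷ (con 32 :< p) ∷
          (a :≤ con 6) ∷ (b :≤ con 6) ∷ (a :+ b :+ m :≡ p) ∷ (j :+ (con 1 :+ m) :< z :+ p) ∷ [])
        (x ∷ m ∷ e ∷ p ∷ z ∷ j ∷ A p ∷ B p ∷ []) lt e+n z<e 32<p A-p B-p p≡ lt′
      empty : ∀ j → suc z ≤ j → j < suc (z + suc m) → f j ≢ 𝐱
      empty j z<j j< fj = [ after-e , before-e ]′ (ℕₚ.≤-<-connex e j)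
        where
        before-e : j < e → ⊥
        before-e j<e = constant 𝐱 (ℕₚ.≤-reflexive (trans A-e (sym (#-hit fz)))) z<j j<e fj
        after-e : e ≤ j → ⊥
        after-e e≤j =
          [ not-apart fx fj (subst (_≤ j + suc m) e+n (ℕₚ.+-monoˡ-≤ (suc m) e≤j))
          , (λ j> → not-apart fz fj (wrapped j>) (ℕₚ.≤-pred j<)) ]′ (ℕₚ.≤-<-connex j (x + suc m))
      A-gap : A (suc (z + suc m)) ≤ suc (A z)
      A-gap = ℕₚ.≤-trans (none 𝐱 (suc (z + suc m)) empty) (ℕₚ.≤-reflexive (#-hit fz))
      next-c : ∃[ c ] z ≤ c × c < z + p × f c ≡ 𝐜 × B c ≡ B z
      next-c = first 𝐜 (z + p) (ℕₚ.m≤m+n z p) (within-period 𝐜 z 5≤B-p)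
      c : ℕ
      c = proj₁ next-c
      fc = proj₁ (proj₂ (proj₂ (proj₂ next-c)))
      B-c : B c ≡ B z
      B-c = proj₂ (proj₂ (proj₂ (proj₂ next-c)))
      z<c : z < c
      z<c = ℕₚ.≤∧≢⇒< (proj₁ (proj₂ next-c)) (apart fz fc)
      near : c ≤ z + suc m → ⊥
      near c≤ = ℕₚ.<⇒≱ (narrow-x (record { x<c = z<c ; fx = fz ; fc = fc ; B-c = B-c
            ; A-c = ℕₚ.≤-antisym (ℕₚ.≤-trans (#-mono 𝐱 (ℕₚ.m≤n⇒m≤1+n c≤)) A-gap)
                (ℕₚ.≤-trans (ℕₚ.≤-reflexive (sym (#-hit fz))) (#-mono 𝐱 z<c)) })
          (ℕₚ.≤-trans m≤x (ℕₚ.≤-trans (proj₁ (proj₂ last-x)) (ℕₚ.<⇒≤ z<c))))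
        (ℕₚ.≤-trans (#-mono 𝐱 (s≤s (ℕₚ.+-monoʳ-≤ z (ℕₚ.n≤1+n m)))) A-gap)
      far : z + suc m < c → ⊥
      far <c = timeline (z ∷ suc (z + suc m) ∷ z + p ∷ [])
        (ℕₚ.m≤n⇒m≤1+n (ℕₚ.m≤m+n z (suc m)) , ℕₚ.≤-trans (ℕₚ.≤-reflexive (sym (ℕₚ.+-suc z (suc m))))
          (ℕₚ.+-monoʳ-≤ z (ℕₚ.≤-pred (ℕₚ.≤-trans (ℕₚ.+-monoˡ-≤ m (s≤s (s≤s (s≤s z≤n)))) 11+m≤p))) , tt) (m ∷ [])
        (λ Z V Q m → (loc V :≡ con 1 :+ (loc Z :+ (con 1 :+ m))) ∷ (xs V :≤ con 1 :+ xs Z) ∷ (cs V :≤ cs Z) ∷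
            (ns Q :≡ ns Z :+ m) ∷ [])
        refl A-gap (ℕₚ.≤-trans (#-mono 𝐜 <c) (ℕₚ.≤-reflexive B-c)) (D-shift z)

    step-from : ∀ b → m + p ≤ b → f b ≡ 𝐜 → ∃[ v ] ∃[ c ] Step b v c
    step-from b le fb = subst (λ b → f b ≡ 𝐜 → ∃[ v ] ∃[ c ] Step b v c)
      (ℕₚ.m∸n+n≡m (ℕₚ.≤-trans (ℕₚ.m≤n+m p m) le)) (step (b ∸ p) (ℕₚ.m+n≤o⇒m≤o∸n m le)) fb

    -- Takes two steps. If they end by v + p, they use 2 (m - 4) > m letters 𝐧 of one period.
    -- Otherwise they cover the period from v, which therefore has at most 2 + 4 letters 𝐱 and as
    -- many 𝐜.
    many : 9 ≤ m → ⊥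
    many 9≤m =
      let b , le , _ , fb , _ = first 𝐜 (m + p + p) (ℕₚ.m≤m+n (m + p) p) (within-period 𝐜 (m + p) 5≤B-p)
          v , c , st = step-from b le fb
          v′ , c′ , st′ = step-from c (ℕₚ.≤-trans le (ℕₚ.≤-trans (Step.b≤v st) (v≤c st))) (Step.fc st)
      in [ once st st′ , twice st st′ ]′ (ℕₚ.≤-<-connex c′ (v + p))
      where
      v≤c : ∀ {b v c} → Step b v c → v ≤ c
      v≤c {v = v} st = subst (v ≤_) (Step.v+m st) (ℕₚ.m≤m+n v m)
      once : ∀ {b v c v′ c′} → Step b v c → Step c v′ c′ → c′ ≤ v + p → ⊥
      once {b} {v} {c} {v′} {c′} st st′ le = timeline (v ∷ c ∷ v′ ∷ c′ ∷ v + p ∷ [])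
        (v≤c st , Step.b≤v st′ , v≤c st′ , le , tt) (m ∷ [])
        (λ V C V′ C′ Q m → (loc V :+ m :≡ loc C) ∷ (loc V′ :+ m :≡ loc C′) ∷ (xs C :≤ con 2 :+ xs V) ∷
            (cs C :≤ con 2 :+ cs V) ∷
          (xs C′ :≤ con 2 :+ xs V′) ∷ (cs C′ :≤ con 2 :+ cs V′) ∷ (ns Q :≡ ns V :+ m) ∷ (con 9 :≤ m) ∷ [])
        (Step.v+m st) (Step.v+m st′) (Step.A-v st) (Step.B-v st) (Step.A-v st′) (Step.B-v st′) (D-shift v) 9≤m
      bound : ∀ l {v c c′} → # l c ≤ 2 + # l v → # l c′ ≤ 4 + # l c → v + p < c′ → # l p ≤ 6
      bound l {v} {c} {c′} le le′ lt = ℕₚ.≮⇒≥ λ lt′ → linear 5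
        (λ a v c c′ q → (c :≤ con 2 :+ v) ∷ (c′ :≤ con 4 :+ c) ∷ (q :≤ c′) ∷ (q :≡ v :+ a) ∷ (con 6 :< a) ∷ [])
        (# l p ∷ # l v ∷ # l c ∷ # l c′ ∷ # l (v + p) ∷ []) le le′ (#-mono l (ℕₚ.<⇒≤ lt)) (#-shift l v) lt′
      twice : ∀ {b v c v′ c′} → Step b v c → Step c v′ c′ → v + p < c′ → ⊥
      twice {c = c} st st′ lt = crowded-x (bound 𝐱 {c = c} (Step.A-v st) (Step.A-b st′) lt)
          (bound 𝐜 {c = c} (Step.B-v st) (Step.B-b st′) lt)

-- Reversing the word

swap : Letter → Letter
swap 𝐱 = 𝐜
swap 𝐜 = 𝐱
swap 𝐧 = 𝐧

swap-involutive : ∀ l → swap (swap l) ≡ l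
swap-involutive 𝐱 = refl
swap-involutive 𝐜 = refl
swap-involutive 𝐧 = refl

is-swap : ∀ l k → is l (swap k) ≡ is (swap l) k
is-swap 𝐱 𝐱 = refl
is-swap 𝐱 𝐜 = refl
is-swap 𝐱 𝐧 = refl
is-swap 𝐜 𝐱 = refl
is-swap 𝐜 𝐜 = refl
is-swap 𝐜 𝐧 = refl
is-swap 𝐧 𝐱 = refl
is-swap 𝐧 𝐜 = refl
is-swap 𝐧 𝐧 = refl

module Dual (cfg : Configuration) where
  open Core cfg

  f-multiple : ∀ n i → f (i + n * p) ≡ f i
  f-multiple zero i = cong f (ℕₚ.+-identityʳ i)
  f-multiple (suc n) i = trans (cong f (trans (cong (i +_) (ℕₚ.+-comm p (n * p))) (sym (ℕₚ.+-assoc i (n * p) p))))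
    (trans (period (i + n * p)) (f-multiple n i))

  -- Since p - 1 ≡ -1 modulo p, this reads the word backwards without subtracting from the position.
  g : ℕ → Letter
  g i = swap (f (i * ℕ.pred p))

  module G = Counting g

  instance
    p≢0 : NonZero p
    p≢0 = ℕ.>-nonZero (ℕₚ.≤-trans (s≤s z≤n) 32<p)

  i*pred+i : ∀ i → i * ℕ.pred p + i ≡ i * p
  i*pred+i i = trans (ℕₚ.+-comm (i * ℕ.pred p) i) (trans (sym (ℕₚ.*-suc i (ℕ.pred p))) (cong (i *_) (ℕₚ.suc-pred p)))

  g-mirror : ∀ n i j → i + j ≡ n * p → g i ≡ swap (f j)
  g-mirror n i j eq = cong swap (trans (sym (f-multiple n (i * ℕ.pred p)))
    (trans (cong f (trans (cong (i * ℕ.pred p +_) (sym eq)) (trans (sym (ℕₚ.+-assoc (i * ℕ.pred p) i j))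
      (trans (cong (_+ j) (i*pred+i i)) (ℕₚ.+-comm (i * p) j))))) (f-multiple i j)))

  g-period : ∀ i → g (i + p) ≡ g i
  g-period i = cong swap (trans (cong f (trans (ℕₚ.*-distribʳ-+ (ℕ.pred p) i p)
      (cong (i * ℕ.pred p +_) (ℕₚ.*-comm p (ℕ.pred p)))))
    (f-multiple (ℕ.pred p) (i * ℕ.pred p)))

  g-mirror⁻ : ∀ n i j {l} → i + j ≡ n * p → g i ≡ l → f j ≡ swap l
  g-mirror⁻ n i j eq gi = trans (sym (swap-involutive (f j))) (cong swap (trans (sym (g-mirror n i j eq)) gi))

  -- Positions 0 to i of the dual word mirror positions p down to j.
  g-count : ∀ l i j → i + j ≡ p → G.# l (suc i) + # (swap l) j ≡ # (swap l) (suc p)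
  g-count l zero j refl = trans (cong (λ n → n + 0 + # (swap l) p)
      (trans (cong (λ k → bit (is l k)) (g-mirror 1 0 p (sym (ℕₚ.+-identityʳ p)))) (cong bit (is-swap l (f p)))))
    (cong (_+ # (swap l) p) (ℕₚ.+-identityʳ (bit (is (swap l) (f p)))))
  g-count l (suc i) j eq = trans (cong (λ n → n + G.# l (suc i) + # (swap l) j)
      (trans (cong (λ k → bit (is l k)) (g-mirror 1 (suc i) j (trans eq (sym (ℕₚ.+-identityʳ p)))))
          (cong bit (is-swap l (f j)))))
    (trans (shuffle (bit (is (swap l) (f j))) _ _) (g-count l i (suc j) (trans (ℕₚ.+-suc i j) eq)))
    where
    shuffle : ∀ a b c → a + b + c ≡ b + (a + c)
    shuffle = solve-∀

  -- The prefixes of length p + 1 mirror each other; their last letters correspond by periodicity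
  -- and cancel.
  g-total : ∀ l → G.# l p ≡ # (swap l) p
  g-total l = ℕₚ.+-cancelˡ-≡ (bit (is (swap l) (f p))) _ _ (trans (cong (λ k → bit k + G.# l p) last-letter)
    (trans (sym (ℕₚ.+-identityʳ _)) (g-count l p 0 (ℕₚ.+-identityʳ p))))
    where
    last-letter : is (swap l) (f p) ≡ is l (g p)
    last-letter = trans (cong (is (swap l)) (period 0)) (trans (sym (is-swap l (f 0)))
      (cong (is l) (sym (g-mirror 1 p 0 refl))))

  -- An 𝐱 and a 𝐜 at distance j after it become such a pair again, at the same distance, so h and k
  -- stay.
  dual : Configuration
  dual = record
    { f = g ; p = p ; m = m ; h = h ; k = k ; period = g-period
    ; valid = λ i j gi gij j≤m → valid (i * ℕ.pred p + j * ℕ.pred p) j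
        (subst (λ a → f a ≡ 𝐱) (ℕₚ.*-distribʳ-+ (ℕ.pred p) i j) (unswap (i + j) gij))
        (trans (cong f (trans (ℕₚ.+-assoc (i * ℕ.pred p) (j * ℕ.pred p) j) (cong (i * ℕ.pred p +_) (i*pred+i j))))
          (trans (f-multiple j (i * ℕ.pred p)) (unswap i gi))) j≤m
    ; h<k = h<k ; 1≤h = 1≤h ; k≤m = k≤m ; 5≤m = 5≤m ; 32<p = 32<p
    ; D-p = trans (g-total 𝐧) D-p ; 5≤A-p = subst (5 ≤_) (sym (g-total 𝐱)) 5≤B-p
    ; 5≤B-p = subst (5 ≤_) (sym (g-total 𝐜)) 5≤A-p }
    where
    unswap : ∀ i {l} → g i ≡ l → f (i * ℕ.pred p) ≡ swap l
    unswap i gi = trans (sym (swap-involutive _)) (cong swap gi)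

-- Excluding every configuration

mirror-< : ∀ {a b c d n} → a + b ≡ n → c + d ≡ n → a < c → d < b
mirror-< {a} {b} {c} {d} {n} eq eq′ lt = ℕₚ.≰⇒> λ le → linear 5
  (λ a b c d n → (a :+ b :≡ n) ∷ (c :+ d :≡ n) ∷ (a :< c) ∷ (b :≤ d) ∷ []) (a ∷ b ∷ c ∷ d ∷ n ∷ []) eq eq′ lt le

mirror-≤ : ∀ {a b c d n} → a + b ≡ n → c + d ≡ n → a ≤ c → d ≤ b
mirror-≤ {a} {b} {c} {d} {n} eq eq′ le = ℕₚ.≮⇒≥ λ lt → linear 5
  (λ a b c d n → (a :+ b :≡ n) ∷ (c :+ d :≡ n) ∷ (a :≤ c) ∷ (b :< d) ∷ []) (a ∷ b ∷ c ∷ d ∷ n ∷ []) eq eq′ le lt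

-- The values of m that `LeftWide.large` leaves open, decided by evaluation. Here 33 is the search
-- depth.
wide-checks : pairs 5 (wideSearch 5 33) ≡ true × pairs 6 (wideSearch 6 33) ≡ true
wide-checks = refl , refl

module _ (cfg : Configuration) where
  open Core cfg

  wide-x-impossible : ∀ {u x} → Transition x (u + m) → B (u + m) ≡ B u → suc (A x) < A (suc (x + m)) → ⊥
  wide-x-impossible tr B-u inner =
    [ (λ 5<m → [ LeftWide.large cfg tr B-u inner
               , (λ 6≡m → LeftWide.small cfg tr B-u inner
                   (subst (λ n → pairs n (wideSearch n 33) ≡ true) 6≡m (proj₂ wide-checks))) ]′
               (ℕₚ.m≤n⇒m<n∨m≡n 5<m))
    , (λ 5≡m → LeftWide.small cfg tr B-u inner (subst (λ n → pairs n (wideSearch n 33) ≡ true) 5≡m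
        (proj₁ wide-checks))) ]′
    (ℕₚ.m≤n⇒m<n∨m≡n 5≤m)

module _ (cfg : Configuration) where
  open Core cfg
  open Dual cfg
  module Dualized = Core dual

  wide-c-impossible : ∀ {u x} → Transition x (u + m) → A (suc (x + m)) ≤ suc (A x) → B u < B (u + m) → ⊥
  wide-c-impossible {u} {x} tr A-y B-u = wide-x-impossible dual {u′} {x′} tr′ B-u′ inner′
    where
    open Transition tr
    c n M x′ c′ u′ : ℕ
    c = u + m
    -- Makes `n * p` a multiple of p not below any position involved, so that subtraction from it is
    -- a reflection.
    n = c + m
    M = n * p
    x′ = M ∸ c
    c′ = M ∸ x
    u′ = c′ ∸ m
    n≤M : c + m ≤ M
    n≤M = ℕₚ.m≤m*n n p
    x′+c : x′ + c ≡ M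
    x′+c = ℕₚ.m∸n+n≡m (ℕₚ.≤-trans (ℕₚ.m≤m+n c m) n≤M)
    c′+x : c′ + x ≡ M
    c′+x = ℕₚ.m∸n+n≡m (ℕₚ.≤-trans (ℕₚ.<⇒≤ x<c) (ℕₚ.≤-trans (ℕₚ.m≤m+n c m) n≤M))
    m≤c′ : m ≤ c′
    m≤c′ = ℕₚ.m+n≤o⇒m≤o∸n m (ℕₚ.≤-trans (ℕₚ.+-monoʳ-≤ m (ℕₚ.<⇒≤ x<c))
        (ℕₚ.≤-trans (ℕₚ.≤-reflexive (ℕₚ.+-comm m c)) n≤M))
    u′+m : u′ + m ≡ c′
    u′+m = ℕₚ.m∸n+n≡m m≤c′
    reflect : ∀ {j} → j < c′ → ∃[ i ] j + i ≡ M
    reflect {j} j<c′ = M ∸ j , ℕₚ.m+[n∸m]≡n (ℕₚ.≤-trans (ℕₚ.<⇒≤ j<c′) (ℕₚ.m∸n≤m M x))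
    x′<c′ : x′ < c′
    x′<c′ = mirror-< (trans (ℕₚ.+-comm x c′) c′+x) (trans (ℕₚ.+-comm c x′) x′+c) x<c
    gx′ : g x′ ≡ 𝐱
    gx′ = trans (g-mirror n x′ c x′+c) (cong swap fc)
    gc′ : g c′ ≡ 𝐜
    gc′ = trans (g-mirror n c′ x c′+x) (cong swap fx)
    no-x : ∀ j → suc x′ ≤ j → j < c′ → g j ≢ 𝐱
    no-x j x′<j j<c′ gj = let i , eq = reflect j<c′ in
      constant 𝐜 (ℕₚ.≤-reflexive B-c) (ℕₚ.<⇒≤ (mirror-< eq c′+x j<c′)) (mirror-< x′+c eq x′<j) (g-mirror⁻ n j i eq gj)
    no-c : ∀ j → x′ ≤ j → j < c′ → g j ≢ 𝐜
    no-c j x′≤j j<c′ gj = let i , eq = reflect j<c′ in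
      constant 𝐱 {suc x} {suc c} (ℕₚ.≤-reflexive (trans (#-skip-c fc) (trans A-c (sym (#-hit fx)))))
        (mirror-< eq c′+x j<c′) (s≤s (mirror-≤ x′+c eq x′≤j)) (g-mirror⁻ n j i eq gj)
    tr′ : Dualized.Transition x′ (u′ + m)
    tr′ = subst (Dualized.Transition x′) (sym u′+m) record
      { x<c = x′<c′ ; fx = gx′ ; fc = gc′
      ; A-c = ℕₚ.≤-antisym (ℕₚ.≤-trans (G.none 𝐱 c′ no-x) (ℕₚ.≤-reflexive (G.#-hit {𝐱} {x′} gx′)))
          (ℕₚ.≤-trans (ℕₚ.≤-reflexive (sym (G.#-hit {𝐱} {x′} gx′))) (G.#-mono 𝐱 x′<c′))
      ; B-c = ℕₚ.≤-antisym (G.none 𝐜 c′ no-c) (G.#-mono 𝐜 (ℕₚ.<⇒≤ x′<c′)) }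
    u′+[x+m] : u′ + (x + m) ≡ M
    u′+[x+m] = trans (cong (u′ +_) (ℕₚ.+-comm x m)) (trans (sym (ℕₚ.+-assoc u′ m x)) (trans (cong (_+ x) u′+m) c′+x))
    B-u′ : G.B (u′ + m) ≡ G.B u′
    B-u′ = ℕₚ.≤-antisym (G.none 𝐜 {u′} (u′ + m) λ j u′≤j j< gj →
        let j<c′ = subst (j <_) u′+m j<
            i , eq = reflect j<c′
        in constant 𝐱 {suc x} {suc (x + m)} (ℕₚ.≤-trans A-y (ℕₚ.≤-reflexive (sym (#-hit fx))))
          (mirror-< eq c′+x j<c′) (s≤s (mirror-≤ u′+[x+m] eq u′≤j)) (g-mirror⁻ n j i eq gj))
      (G.#-mono 𝐜 (ℕₚ.m≤m+n u′ m))
    inner′ : suc (G.A x′) < G.A (suc (x′ + m))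
    inner′ = let e , u≤e , e<c , fe , _ = first 𝐜 c (ℕₚ.m≤m+n u m) B-u
                 e′ = M ∸ e
                 eq : e′ + e ≡ M
                 eq = ℕₚ.m∸n+n≡m (ℕₚ.≤-trans (ℕₚ.<⇒≤ e<c) (ℕₚ.≤-trans (ℕₚ.m≤m+n c m) n≤M))
                 ge′ : g e′ ≡ 𝐱
                 ge′ = trans (g-mirror n e′ e eq) (cong swap fe)
                 x′<e′ : x′ < e′
                 x′<e′ = mirror-< (trans (ℕₚ.+-comm e e′) eq) (trans (ℕₚ.+-comm c x′) x′+c) e<c
                 e′≤ : e′ ≤ x′ + m
                 e′≤ = mirror-≤ (trans (ℕₚ.+-comm u (x′ + m))
                     (trans (ℕₚ.+-assoc x′ m u) (trans (cong (x′ +_) (ℕₚ.+-comm m u)) x′+c)))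
                     (trans (ℕₚ.+-comm e e′) eq) u≤e
             in ℕₚ.≤-trans (s≤s (ℕₚ.≤-trans (ℕₚ.≤-reflexive (sym (G.#-hit {𝐱} {x′} gx′))) (G.#-mono 𝐱 x′<e′)))
                  (ℕₚ.≤-trans (ℕₚ.≤-reflexive (sym (G.#-hit {𝐱} {e′} ge′))) (G.#-mono 𝐱 (s≤s e′≤)))

-- The values of m below the bound 9 of `many`.
steep-checks : pairs 5 (steepSearch 5 33) ≡ true × pairs 6 (steepSearch 6 33) ≡ true ×
               pairs 7 (steepSearch 7 33) ≡ true × pairs 8 (steepSearch 8 33) ≡ true
steep-checks = refl , refl , refl , refl

module _ (cfg : Configuration) where
  open Core cfg
  open NarrowCase cfg

  narrow-impossible : Narrow → ⊥
  narrow-impossible narrow =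
    let c₅ , c₆ , c₇ , c₈ = steep-checks in
    at 5 c₅ 5≤m λ 5<m → at 6 c₆ 5<m λ 6<m → at 7 c₇ 6<m λ 7<m → at 8 c₈ 7<m (many narrow)
    where
    at : ∀ n → pairs n (steepSearch n 33) ≡ true → n ≤ m → (n < m → ⊥) → ⊥
    at n ok n≤m next = [ next , (λ n≡m → few narrow 33 (pairs-sound m (steepSearch m 33)
      (subst (λ n → pairs n (steepSearch n 33) ≡ true) n≡m ok) 1≤h h<k k≤m)) ]′ (ℕₚ.m≤n⇒m<n∨m≡n n≤m)

  spread-impossible : Spread → ⊥
  spread-impossible spread = narrow-impossible λ {u} {x} tr → classify tr
      (ℕₚ.≤-<-connex (A (suc (x + m))) (suc (A x))) (ℕₚ.≤-<-connex (B (u + m)) (B u))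
    where
    classify : ∀ {u x} → Transition x (u + m) →
      A (suc (x + m)) ≤ suc (A x) ⊎ suc (A x) < A (suc (x + m)) → B (u + m) ≤ B u ⊎ B u < B (u + m) →
      suc (A x) < A (suc (x + m)) × B u < B (u + m)
    classify {u} {x} tr (inj₁ a) (inj₁ b) = ⊥-elim (WideTransition.absurd tr (same b) (ℕₚ.≤-antisym a
        (ℕₚ.≤-trans (ℕₚ.≤-reflexive (sym (#-hit (Transition.fx tr)))) (#-mono 𝐱 (s≤s (ℕₚ.m≤m+n x m))))) spread)
      where
      same : B (u + m) ≤ B u → B (u + m) ≡ B u
      same b = ℕₚ.≤-antisym b (#-mono 𝐜 (ℕₚ.m≤m+n u m))
    classify {u} tr (inj₂ a) (inj₁ b) = ⊥-elim (wide-x-impossible cfg tr (ℕₚ.≤-antisym b (#-mono 𝐜 (ℕₚ.m≤m+n u m))) a)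
    classify tr (inj₁ a) (inj₂ b) = ⊥-elim (wide-c-impossible cfg tr a b)
    classify tr (inj₂ a) (inj₂ b) = a , b

-- Subsets of ℤ/pℤ as words

foldr-⊓⁻ : ∀ d ns {n} → List.foldr _⊓_ d ns ≤ n → d ≤ n ⊎ Any (_≤ n) ns
foldr-⊓⁻ d [] le = inj₁ le
foldr-⊓⁻ d (k ∷ ns) le with ℕₚ.⊓-sel k (List.foldr _⊓_ d ns)
... | inj₁ eq = inj₂ (here (subst (_≤ _) eq le))
... | inj₂ eq = Sum.map₂ there (foldr-⊓⁻ d ns (subst (_≤ _) eq le))

foldr-⊓⁺ : ∀ d ns {n} → Any (_≤ n) ns → List.foldr _⊓_ d ns ≤ n
foldr-⊓⁺ d (k ∷ ns) (here k≤) = ℕₚ.≤-trans (ℕₚ.m⊓n≤m k _) k≤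
foldr-⊓⁺ d (k ∷ ns) (there any) = ℕₚ.≤-trans (ℕₚ.m⊓n≤n k _) (foldr-⊓⁺ d ns any)

-- The branching function inside ℓ is local to its definition, so it can only be reached by unification with F.
select⁻ : ∀ {A B : Set} (F : A → B → List ℕ) d {n} as bs →
  List.foldr _⊓_ d (concatMap (λ a → concatMap (F a) bs) as) ≤ n →
  d ≤ n ⊎ ∃[ a ] ∃[ b ] b ∈ˡ bs × Any (_≤ n) (F a b)
select⁻ F d as bs le = Sum.map₂ unpack (foldr-⊓⁻ d _ le)
  where
  unpack : ∀ {n} → Any (_≤ n) (concatMap (λ a → concatMap (F a) bs) as) → ∃[ a ] ∃[ b ] b ∈ˡ bs × Any (_≤ n) (F a b)
  unpack any =
    let a , _ , any′ = find (concatMap⁻ (λ a → concatMap (F a) bs) {xs = as} any)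
        b , b∈ , any″ = find (concatMap⁻ (F a) {xs = bs} any′)
    in a , b , b∈ , any″

select⁺ : ∀ {A B : Set} (F : A → B → List ℕ) d {v} as bs →
  List.foldr _⊓_ d (concatMap (λ a → concatMap (F a) bs) as) ≡ v →
  ∀ n {a b} → a ∈ˡ as → b ∈ˡ bs → Any (_≤ n) (F a b) → v ≤ n
select⁺ F d as bs eq n a∈ b∈ any = subst (_≤ n) eq
  (foldr-⊓⁺ d _ (concatMap⁺ (λ a → concatMap (F a) bs) (lose a∈ (concatMap⁺ (F _) (lose b∈ any)))))

-- Progressions of difference one and the minimum in `ℓ`

module _ {p : ℕ} .{{_ : NonZero p}} where

  ℓ-attained : ∀ r (Z : Subset p) {n} → ℓ r Z ≤ n → n < p →
    ∃[ a ] ∃[ k ] k ≤ p × Z ⊆ AP a r k × ∣ AP a r k ∣ ≤ n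
  ℓ-attained r Z {n} le n<p with select⁻ _ p (allFin p) (upTo (suc p)) le
  ... | inj₁ p≤n = ⊥-elim (ℕₚ.<⇒≱ n<p p≤n)
  ... | inj₂ (a , k , k∈ , any) with Z ⊆? AP a r k
  ...   | yes Z⊆ with any
  ...     | here le′ = a , k , ℕₚ.≤-pred (∈-upTo⁻ k∈) , Z⊆ , le′
  ℓ-attained r Z {n} le n<p | inj₂ (a , k , k∈ , ()) | no _

  ℓ-bounded : ∀ r (Z : Subset p) {n} a k → k ≤ p → Z ⊆ AP a r k → ∣ AP a r k ∣ ≤ n → ℓ r Z ≤ n
  ℓ-bounded r Z {n} a k k≤p Z⊆ le
    with select⁺ _ p {ℓ r Z} (allFin p) (upTo (suc p)) refl n (∈-allFin a) (∈-upTo⁺ (s≤s k≤p))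
  ... | introduce with Z ⊆? AP a r k
  ...   | yes _ = introduce (here le)
  ...   | no ⊈ = ⊥-elim (⊈ Z⊆)

  mod-cong : ∀ {i j} → i % p ≡ j % p → i mod p ≡ j mod p
  mod-cong {i} {j} eq = Finₚ.fromℕ<-cong _ _ eq (m%n<n i p) (m%n<n j p)

  toℕ-mod : ∀ i → toℕ (i mod p) ≡ i % p
  toℕ-mod i = Finₚ.toℕ-fromℕ< (m%n<n i p)

  mod-toℕ : ∀ (z : Fin p) → toℕ z mod p ≡ z
  mod-toℕ z = Finₚ.toℕ-injective (trans (toℕ-mod (toℕ z)) (m<n⇒m%n≡m (Finₚ.toℕ<n z)))

  mod-+ : ∀ i j → (i mod p) +ₚ (j mod p) ≡ (i + j) mod p
  mod-+ i j = mod-cong (trans (cong₂ (λ a b → (a + b) % p) (toℕ-mod i) (toℕ-mod j)) (sym (%-distribˡ-+ i j p)))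

  AP-suc : ∀ i k → AP (i mod p) oneₚ (suc k) ≡ ⁅ i mod p ⁆ ∪ AP (suc i mod p) oneₚ k
  AP-suc i k = cong (λ a → ⁅ i mod p ⁆ ∪ AP a oneₚ k) (trans (mod-+ i 1) (cong (_mod p) (ℕₚ.+-comm i 1)))

  AP⁺ : ∀ k i j → j < k → (i + j) mod p ∈ AP (i mod p) oneₚ k
  AP⁺ (suc k) i zero _ = subst ((i + 0) mod p ∈_) (sym (AP-suc i k))
    (x∈p∪q⁺ (inj₁ (subst (λ n → n mod p ∈ ⁅ i mod p ⁆) (sym (ℕₚ.+-identityʳ i)) (x∈⁅x⁆ (i mod p)))))
  AP⁺ (suc k) i (suc j) (s≤s j<k) = subst ((i + suc j) mod p ∈_) (sym (AP-suc i k))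
    (x∈p∪q⁺ (inj₂ (subst (λ n → n mod p ∈ AP (suc i mod p) oneₚ k) (sym (ℕₚ.+-suc i j)) (AP⁺ k (suc i) j j<k))))

  AP⁻ : ∀ k i {z} → z ∈ AP (i mod p) oneₚ k → ∃[ j ] j < k × z ≡ (i + j) mod p
  AP⁻ zero i z∈ = ⊥-elim (∉⊥ z∈)
  AP⁻ (suc k) i {z} z∈ with x∈p∪q⁻ ⁅ i mod p ⁆ _ (subst (z ∈_) (AP-suc i k) z∈)
  ... | inj₁ z∈⁅⁆ = 0 , s≤s z≤n , trans (x∈⁅y⁆⇒x≡y _ z∈⁅⁆) (cong (_mod p) (sym (ℕₚ.+-identityʳ i)))
  ... | inj₂ z∈AP = let j , j<k , eq = AP⁻ k (suc i) z∈AP in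
    suc j , s≤s j<k , trans eq (cong (_mod p) (sym (ℕₚ.+-suc i j)))

∣∪∣≤ : ∀ {n} (S R : Subset n) → ∣ S ∪ R ∣ ≤ ∣ S ∣ + ∣ R ∣
∣∪∣≤ [] [] = z≤n
∣∪∣≤ (true ∷ S) (true ∷ R) = s≤s (ℕₚ.≤-trans (∣∪∣≤ S R) (ℕₚ.+-monoʳ-≤ ∣ S ∣ (ℕₚ.n≤1+n ∣ R ∣)))
∣∪∣≤ (true ∷ S) (false ∷ R) = s≤s (∣∪∣≤ S R)
∣∪∣≤ (false ∷ S) (true ∷ R) = ℕₚ.≤-trans (s≤s (∣∪∣≤ S R)) (ℕₚ.≤-reflexive (sym (ℕₚ.+-suc ∣ S ∣ ∣ R ∣)))
∣∪∣≤ (false ∷ S) (false ∷ R) = ∣∪∣≤ S R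

∣AP∣≤ : ∀ {p} .{{_ : NonZero p}} (a r : Fin p) k → ∣ AP a r k ∣ ≤ k
∣AP∣≤ {p} a r zero = ℕₚ.≤-reflexive (∣⊥∣≡0 p)
∣AP∣≤ a r (suc k) = ℕₚ.≤-trans (∣∪∣≤ ⁅ a ⁆ _)
  (ℕₚ.≤-trans (ℕₚ.≤-reflexive (cong (_+ ∣ AP (a +ₚ r) r k ∣) (∣⁅x⁆∣≡1 a))) (s≤s (∣AP∣≤ (a +ₚ r) r k)))

pre-head : ∀ g n → pre g (suc n) ≡ bit (g 0) + pre (g ∘ suc) n
pre-head g zero = refl
pre-head g (suc n) rewrite pre-head g n = shuffle (bit (g (suc n))) (bit (g 0)) _
  where
  shuffle : ∀ a b c → a + (b + c) ≡ b + (a + c)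
  shuffle = solve-∀

pre-card : ∀ {n} (S : Subset n) g → (∀ i → g (toℕ i) ≡ lookup S i) → pre g n ≡ ∣ S ∣
pre-card [] g eq = refl
pre-card {suc n} (true ∷ S) g eq = trans (pre-head g n) (trans (cong (λ b → bit b + pre (g ∘ suc) n) (eq Fin.zero))
  (cong suc (pre-card S (g ∘ suc) (eq ∘ Fin.suc))))
pre-card {suc n} (false ∷ S) g eq = trans (pre-head g n) (trans (cong (λ b → bit b + pre (g ∘ suc) n) (eq Fin.zero))
  (pre-card S (g ∘ suc) (eq ∘ Fin.suc)))

pre-shift : ∀ g a n → pre (λ i → g (i + a)) n + pre g a ≡ pre g (n + a)
pre-shift g a zero = refl
pre-shift g a (suc n) = trans (ℕₚ.+-assoc (bit (g (n + a))) _ _) (cong (bit (g (n + a)) +_) (pre-shift g a n))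

pre-not : ∀ g n → pre (not ∘ g) n + pre g n ≡ n
pre-not g zero = refl
pre-not g (suc n) with g n
... | true = trans (ℕₚ.+-suc _ _) (cong suc (pre-not g n))
... | false = cong suc (pre-not g n)

pre-full : ∀ g n → (∀ i → i < n → g i ≡ true) → pre g n ≡ n
pre-full g zero full = refl
pre-full g (suc n) full rewrite full n ℕₚ.≤-refl = cong suc (pre-full g n λ i i<n → full i (ℕₚ.m≤n⇒m≤1+n i<n))

exactly-two : ∀ g t → pre g t ≡ 2 →
  ∃[ h ] ∃[ k ] h < k × k < t × g h ≡ true × (∀ j → j < t → g j ≡ true → j ≡ h ⊎ j ≡ k)
exactly-two g t eq =
  let k , _ , k<t , gk , e₁ = pre-last g {0} t z≤n (subst (0 <_) (sym eq) (s≤s z≤n))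
      one = ℕₚ.suc-injective (trans (sym e₁) eq)
      h , _ , h<k , gh , e₀ = pre-last g {0} k z≤n (subst (0 <_) (sym one) (s≤s z≤n))
      none = ℕₚ.suc-injective (trans (sym e₀) one)
  in h , k , h<k , k<t , gh , located h k h<k k<t gh gk one none
  where
  located : ∀ h k → h < k → k < t → g h ≡ true → g k ≡ true → pre g k ≡ 1 → pre g h ≡ 0 →
    ∀ j → j < t → g j ≡ true → j ≡ h ⊎ j ≡ k
  located h k h<k k<t gh gk one none j j<t gj with ℕₚ.<-cmp j h | ℕₚ.<-cmp j k
  ... | tri≈ _ j≡h _ | _ = inj₁ j≡h
  ... | _ | tri≈ _ j≡k _ = inj₂ j≡k
  ... | tri< j<h _ _ | _ = ⊥-elim (pre-constant g {0} (ℕₚ.≤-reflexive none) z≤n j<h gj)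
  ... | tri> _ _ h<j | tri< j<k _ _ = ⊥-elim (pre-constant g
      (ℕₚ.≤-reflexive (trans one (sym (trans (pre-hit g gh) (cong suc none))))) h<j j<k gj)
  ... | tri> _ _ _ | tri> _ _ k<j = ⊥-elim (pre-constant g
      (ℕₚ.≤-reflexive (trans eq (sym (trans (pre-hit g gk) (cong suc one))))) k<j j<t gj)

module _ {p : ℕ} .{{_ : NonZero p}} where

  χ : Subset p → ℕ → Bool
  χ S i = lookup S (i mod p)

  χ-period : ∀ S i → χ S (i + p) ≡ χ S i
  χ-period S i = cong (lookup S) (mod-cong ([m+n]%n≡m%n i p))

  χ-window : ∀ S i → pre (χ S) (i + p) ≡ pre (χ S) i + ∣ S ∣
  χ-window S i = trans (pre-period (χ S) (χ-period S) i)
    (cong (pre (χ S) i +_) (pre-card S (χ S) (cong (lookup S) ∘ mod-toℕ)))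

  χ-shifted : ∀ S a → pre (λ i → χ S (i + a)) p ≡ ∣ S ∣
  χ-shifted S a = ℕₚ.+-cancelʳ-≡ (pre (χ S) a) _ _ (trans (pre-shift (χ S) a p)
    (trans (cong (pre (χ S)) (ℕₚ.+-comm p a)) (trans (χ-window S a) (ℕₚ.+-comm _ ∣ S ∣))))

  χ-⊕ : ∀ X Y i j → χ X i ≡ true → χ Y j ≡ true → χ (X ⊕ Y) (i + j) ≡ true
  χ-⊕ X Y i j xi yj = trans (lookup∘tabulate _ ((i + j) mod p)) (Equivalence.to T-≡
    (any⁺ _ (lose (∈-allFin (i mod p)) (any⁺ _ (lose (∈-allFin (j mod p))
      (Equivalence.from T-∧ (Equivalence.from T-≡ xi , Equivalence.from T-∧
          (Equivalence.from T-≡ yj , fromWitness (mod-+ i j)))))))))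

  -- Equal remainders with different quotients would put d and e at least p apart.
  mod-injective : ∀ i {d e} → d < p → e < p → (d + i) % p ≡ (e + i) % p → d ≡ e
  mod-injective i {d} {e} d<p e<p eq with ℕₚ.<-cmp ((d + i) / p) ((e + i) / p)
  ... | tri≈ _ q≡ _ = ℕₚ.+-cancelʳ-≡ i d e (trans (m≡m%n+[m/n]*n (d + i) p)
          (trans (cong₂ (λ r q → r + q * p) eq q≡) (sym (m≡m%n+[m/n]*n (e + i) p))))
  ... | tri< q< _ _ = ⊥-elim (linear 7
          (λ d e i p r s t → (d :+ i :≡ r :+ s) ∷ (e :+ i :≡ r :+ t) ∷ (p :+ s :≤ t) ∷ (e :< p) ∷ [])
          (d ∷ e ∷ i ∷ p ∷ (d + i) % p ∷ (d + i) / p * p ∷ (e + i) / p * p ∷ [])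
          (m≡m%n+[m/n]*n (d + i) p) (trans (m≡m%n+[m/n]*n (e + i) p) (cong (_+ (e + i) / p * p) (sym eq)))
          (ℕₚ.*-monoˡ-≤ p q<) e<p)
  ... | tri> _ _ q> = ⊥-elim (linear 7
          (λ d e i p r s t → (d :+ i :≡ r :+ s) ∷ (e :+ i :≡ r :+ t) ∷ (p :+ t :≤ s) ∷ (d :< p) ∷ [])
          (d ∷ e ∷ i ∷ p ∷ (d + i) % p ∷ (d + i) / p * p ∷ (e + i) / p * p ∷ [])
          (m≡m%n+[m/n]*n (d + i) p) (trans (m≡m%n+[m/n]*n (e + i) p) (cong (_+ (e + i) / p * p) (sym eq)))
          (ℕₚ.*-monoˡ-≤ p q>) d<p)

  -- Read from i, the first k places of the indicator are all occupied, and p places count each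
  -- element once.
  ≤∣AP∣ : ∀ i k → k ≤ p → k ≤ ∣ AP (i mod p) oneₚ k ∣
  ≤∣AP∣ i k k≤p = subst (k ≤_) (χ-shifted Z i) (ℕₚ.≤-trans
      (ℕₚ.≤-reflexive (sym (pre-full (λ j → χ Z (j + i)) k λ j j<k → []=⇒lookup
          (subst (λ n → n mod p ∈ Z) (ℕₚ.+-comm i j) (AP⁺ k i j j<k)))))
      (pre-mono (λ j → χ Z (j + i)) k≤p))
    where
    Z = AP (i mod p) oneₚ k

  -- Moves the start of the progression on to the first element of Y. An element that wrapped around
  -- would fall into [i, a), where Y has none.
  starting-window : ∀ (Y : Subset p) {n} → ℓ oneₚ Y ≤ n → n < p → 1 ≤ ∣ Y ∣ →
    ∃[ a ] χ Y a ≡ true × (∀ e → e < p → χ Y (e + a) ≡ true → e < n)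
  starting-window Y {n} le n<p 1≤Y with ℓ-attained oneₚ Y le n<p
  ... | a₀ , k , k≤p , Y⊆ , ∣AP∣≤n = a , χa , bounded
    where
    i = toℕ a₀
    Y⊆′ : Y ⊆ AP (i mod p) oneₚ k
    Y⊆′ = subst (λ a → Y ⊆ AP a oneₚ k) (sym (mod-toℕ a₀)) Y⊆
    k≤n : k ≤ n
    k≤n = ℕₚ.≤-trans (≤∣AP∣ i k k≤p) (subst (λ a → ∣ AP a oneₚ k ∣ ≤ n) (sym (mod-toℕ a₀)) ∣AP∣≤n)
    near : ∀ e → e < p → χ Y (e + i) ≡ true → e < k
    near e e<p χe = let j , j<k , eq = AP⁻ k i (Y⊆′ (lookup⇒[]= ((e + i) mod p) Y χe)) in
      subst (_< k) (sym (mod-injective i e<p (ℕₚ.<-≤-trans j<k k≤p)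
        (trans (sym (toℕ-mod (e + i))) (trans (cong toℕ eq)
            (trans (toℕ-mod (i + j)) (cong (_% p) (ℕₚ.+-comm i j))))))) j<k
    found : ∃[ a ] i ≤ a × a < i + p × χ Y a ≡ true × pre (χ Y) a ≡ pre (χ Y) i
    found = pre-first (χ Y) (i + p) (ℕₚ.m≤m+n i p) (subst (pre (χ Y) i <_) (sym (χ-window Y i)) (ℕₚ.m<m+n _ 1≤Y))
    a d : ℕ
    a = proj₁ found
    d = a ∸ i
    χa : χ Y a ≡ true
    χa = proj₁ (proj₂ (proj₂ (proj₂ found)))
    d+i : d + i ≡ a
    d+i = ℕₚ.m∸n+n≡m (proj₁ (proj₂ found))
    bounded : ∀ e → e < p → χ Y (e + a) ≡ true → e < n
    bounded e e<p χe = [ wraps , inside ]′ (ℕₚ.≤-<-connex p (e + d))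
      where
      e+d+i : e + d + i ≡ e + a
      e+d+i = trans (ℕₚ.+-assoc e d i) (cong (e +_) d+i)
      inside : e + d < p → e < n
      inside lt = ℕₚ.≤-trans (s≤s (ℕₚ.m≤m+n e d)) (ℕₚ.≤-trans (near (e + d) lt (trans (cong (χ Y) e+d+i) χe)) k≤n)
      wraps : p ≤ e + d → e < n
      wraps p≤ = ⊥-elim (pre-constant (χ Y) (ℕₚ.≤-reflexive (proj₂ (proj₂ (proj₂ (proj₂ found)))))
        (ℕₚ.m≤n+m i r) r+i<a
        (trans (sym (χ-period Y (r + i))) (trans (cong (χ Y) r+i+p) χe)))
        where
        r = e + d ∸ p
        r+p : r + p ≡ e + d
        r+p = ℕₚ.m∸n+n≡m p≤
        r+i+p : r + i + p ≡ e + a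
        r+i+p = trans (ℕₚ.+-assoc r i p) (trans (cong (r +_) (ℕₚ.+-comm i p))
            (trans (sym (ℕₚ.+-assoc r p i)) (trans (cong (_+ i) r+p) e+d+i)))
        r+i<a : r + i < a
        r+i<a = ℕₚ.≰⇒> λ a≤ → linear 5 (λ a r i p e → (a :≤ r :+ i) ∷ (r :+ i :+ p :≡ e :+ a) ∷ (e :< p) ∷ [])
          (a ∷ r ∷ i ∷ p ∷ e ∷ []) a≤ r+i+p e<p

  -- A window with ∣X∣ elements leaves none for the rest of the period.
  covered : ∀ (X : Subset p) s k → k ≤ p → pre (χ X) s + ∣ X ∣ ≤ pre (χ X) (s + k) → ℓ oneₚ X ≤ k
  covered X s k k≤p full = ℓ-bounded oneₚ X (s mod p) k k≤p X⊆ (∣AP∣≤ (s mod p) oneₚ k)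
    where
    X⊆ : X ⊆ AP (s mod p) oneₚ k
    X⊆ {z} z∈ = subst (_∈ AP (s mod p) oneₚ k) s+j≡z (AP⁺ k s j j<k)
      where
      y j : ℕ
      -- Represents z - s, because p - 1 ≡ -1 modulo p.
      y = toℕ z + s * ℕ.pred p
      j = y % p
      s+j≡z : (s + j) mod p ≡ z
      s+j≡z = trans (mod-cong (trans (%-distribˡ-+ s j p) (trans (cong (λ r → (s % p + r) % p) (m%n%n≡m%n y p))
        (trans (sym (%-distribˡ-+ s y p)) (trans (cong (_% p) s+y) ([m+kn]%n≡m%n (toℕ z) s p)))))) (mod-toℕ z)
        where
        s+y : s + y ≡ toℕ z + s * p
        s+y = trans (shuffle s (toℕ z) (s * ℕ.pred p))
            (cong (toℕ z +_) (trans (sym (ℕₚ.*-suc s (ℕ.pred p))) (cong (s *_) (ℕₚ.suc-pred p))))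
          where
          shuffle : ∀ a b c → a + (b + c) ≡ b + (a + c)
          shuffle a b c = trans (sym (ℕₚ.+-assoc a b c)) (trans (cong (_+ c) (ℕₚ.+-comm a b)) (ℕₚ.+-assoc b a c))
      j<k : j < k
      j<k = ℕₚ.≰⇒> λ k≤j → pre-constant (χ X) {s + k} {s + p} (ℕₚ.≤-trans (ℕₚ.≤-reflexive (χ-window X s)) full)
        (ℕₚ.+-monoʳ-≤ s k≤j) (ℕₚ.+-monoʳ-< s (m%n<n y p)) (trans (cong (lookup X) s+j≡z) ([]=⇒lookup z∈))

-- The word of a pair of sets

letter : Bool → Bool → Letter
letter false _ = 𝐜
letter true true = 𝐱
letter true false = 𝐧

letter-𝐜 : ∀ s x → is 𝐜 (letter s x) ≡ not s
letter-𝐜 false _ = refl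
letter-𝐜 true true = refl
letter-𝐜 true false = refl

letter-𝐱 : ∀ s x → (x ≡ true → s ≡ true) → is 𝐱 (letter s x) ≡ x
letter-𝐱 true true _ = refl
letter-𝐱 true false _ = refl
letter-𝐱 false false _ = refl
letter-𝐱 false true imp with imp refl
... | ()

𝐱-letter : ∀ s x → letter s x ≡ 𝐱 → x ≡ true
𝐱-letter true true _ = refl

𝐜-letter : ∀ s x → letter s x ≡ 𝐜 → s ≡ false
𝐜-letter false _ _ = refl
𝐜-letter true true ()
𝐜-letter true false ()

false≢true : false ≢ true
false≢true ()

module Encoding {p : ℕ} .{{_ : NonZero p}} (X Y : Subset p) {a h k : ℕ}
                (size : ∣ X ⊕ Y ∣ ≡ ∣ X ∣ + ∣ Y ∣ + 1) (a∈Y : χ Y a ≡ true) where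

  S : Subset p
  S = X ⊕ Y

  f : ℕ → Letter
  f i = letter (χ S (i + a)) (χ X i)

  open Counting f

  -- As a ∈ Y, every i ∈ X has i + a ∈ X + Y, so no element of X is marked 𝐜.
  A≡ : ∀ t → A t ≡ pre (χ X) t
  A≡ t = pre-cong t λ i _ → letter-𝐱 (χ S (i + a)) (χ X i) λ xi → χ-⊕ X Y i a xi a∈Y

  A-p : A p ≡ ∣ X ∣
  A-p = trans (A≡ p) (χ-window X 0)

  B-p : B p + ∣ S ∣ ≡ p
  B-p = trans (cong₂ _+_ (pre-cong p λ i _ → letter-𝐜 (χ S (i + a)) (χ X i)) (sym (χ-shifted S a)))
      (pre-not (λ i → χ S (i + a)) p)

  absent : ∀ i j → f i ≡ 𝐱 → f (i + j) ≡ 𝐜 → not (χ Y (j + a)) ≡ true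
  absent i j fi fij = cong not (¬-not λ yj → false≢true (trans (sym (𝐜-letter _ (χ X (i + j)) fij))
    (trans (cong (χ S) (ℕₚ.+-assoc i j a)) (χ-⊕ X Y i (j + a) (𝐱-letter (χ S (i + a)) _ fi) yj))))

  f-period : ∀ i → f (i + p) ≡ f i
  f-period i = cong₂ letter (trans (cong (χ S) (+-swap i p a)) (χ-period S (i + a))) (χ-period X i)
    where
    +-swap : ∀ b c d → b + c + d ≡ b + d + c
    +-swap = solve-∀

  -- The 𝐧 mark the ∣X + Y∣ - ∣X∣ elements of the translated sumset outside X.
  D-p : D p ≡ suc ∣ Y ∣
  D-p = ℕₚ.+-cancelˡ-≡ (A p + B p) _ _ (trans (total p) (trans (sym B-p) (trans (cong (B p +_) size)
    (trans (shuffle (B p) ∣ X ∣ ∣ Y ∣) (cong (λ n → n + B p + suc ∣ Y ∣) (sym A-p))))))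
    where
    shuffle : ∀ b x y → b + (x + y + 1) ≡ x + b + suc y
    shuffle = solve-∀

  concentrated : 32 < p → ∣ S ∣ + 5 ≤ p → 4 ≤ ∣ Y ∣ → 5 ≤ ∣ X ∣ → h < k → k < suc (suc ∣ Y ∣) →
    not (χ Y (h + a)) ≡ true →
    (∀ j → j < suc (suc ∣ Y ∣) → not (χ Y (j + a)) ≡ true → j ≡ h ⊎ j ≡ k) →
    (∀ s → pre (χ X) (s + (∣ X ∣ + 2)) < pre (χ X) s + ∣ X ∣) → ⊥
  concentrated 32<p S+5≤p 4≤Y 5≤X h<k k≤m h∉Y located spread = spread-impossible cfg λ s →
    subst₂ _<_ (sym (trans (A≡ (s + (A p + 2))) (cong (λ n → pre (χ X) (s + (n + 2))) A-p)))
      (sym (cong₂ _+_ (A≡ s) A-p)) (spread s)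
    where
    cfg : Configuration
    cfg = record
      { f = f ; p = p ; m = suc ∣ Y ∣ ; h = h ; k = k
      ; period = f-period
      ; valid = λ i j fi fij j≤m → located j (s≤s j≤m) (absent i j fi fij)
      ; h<k = h<k
      -- The missing place h is not 0, since a itself lies in Y.
      ; 1≤h = ℕₚ.n≢0⇒n>0 λ h≡0 → false≢true (trans (cong not (trans (sym a∈Y) (cong (λ j → χ Y (j + a)) (sym h≡0))))
          h∉Y)
      ; k≤m = ℕₚ.≤-pred k≤m
      ; 5≤m = s≤s 4≤Y
      ; 32<p = 32<p
      ; D-p = D-p
      ; 5≤A-p = subst (5 ≤_) (sym A-p) 5≤X
      ; 5≤B-p = ℕₚ.+-cancelʳ-≤ ∣ S ∣ 5 (B p) (ℕₚ.≤-trans (ℕₚ.≤-reflexive (ℕₚ.+-comm 5 ∣ S ∣))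
          (ℕₚ.≤-trans S+5≤p (ℕₚ.≤-reflexive (sym B-p))))
      }

-- All ∣Y∣ elements fall into these ∣Y∣ + 2 places.
two-missing : ∀ {p} .{{_ : NonZero p}} (Y : Subset p) a → ∣ Y ∣ + 2 < p →
  (∀ e → e < p → χ Y (e + a) ≡ true → e < ∣ Y ∣ + 2) →
  pre (λ j → not (χ Y (j + a))) (suc (suc ∣ Y ∣)) ≡ 2
two-missing {p} Y a Y+2<p bounded = ℕₚ.+-cancelʳ-≡ ∣ Y ∣ _ 2
  (trans (cong (pre (not ∘ y) n +_) (sym present)) (pre-not y n))
  where
  y : ℕ → Bool
  y j = χ Y (j + a)
  n : ℕ
  n = suc (suc ∣ Y ∣)
  n≡ : n ≡ ∣ Y ∣ + 2
  n≡ = ℕₚ.+-comm 2 ∣ Y ∣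
  present : pre y n ≡ ∣ Y ∣
  present = trans (ℕₚ.≤-antisym (pre-mono y (ℕₚ.≤-trans (ℕₚ.≤-reflexive n≡) (ℕₚ.<⇒≤ Y+2<p)))
      (pre-none y p λ j n≤j j<p yj → ℕₚ.<⇒≱ (bounded j j<p yj) (subst (_≤ j) n≡ n≤j)))
    (χ-shifted Y a)

theorem3p2 : (p : ℕ) .{{_ : NonZero p}} → Prime p → 32 < p →
    (X Y : Subset p) →
    ∣ X ⊕ Y ∣ ≡ ∣ X ∣ + ∣ Y ∣ + 1 → ∣ X ⊕ Y ∣ ≤ p ∸ 5 →
    4 ≤ ∣ Y ∣ → 5 ≤ ∣ X ∣ →
    ℓ oneₚ Y ≤ ∣ Y ∣ + 2 → ℓ oneₚ X ≤ ∣ X ∣ + 2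
theorem3p2 p _ 32<p X Y size size≤ 4≤Y 5≤X ℓY = ℕₚ.≮⇒≥ λ lt →
  let a , a∈Y , bounded = starting-window Y ℓY Y+2<p (ℕₚ.≤-trans (s≤s z≤n) 4≤Y)
      h , k , h<k , k<n , h∉Y , located = exactly-two _ _ (two-missing Y a Y+2<p bounded)
  in Encoding.concentrated X Y size a∈Y 32<p S+5≤p 4≤Y 5≤X h<k k<n h∉Y located
       -- A window of ∣X∣ + 2 places containing all of X would give the desired bound on `ℓ`; its
       -- absence is `Spread`.
       λ s → ℕₚ.≰⇒> λ le → ℕₚ.<⇒≱ lt (covered X s (∣ X ∣ + 2) X+2≤p le)
  where
  S+5≤p : ∣ X ⊕ Y ∣ + 5 ≤ p
  S+5≤p = ℕₚ.≤-trans (ℕₚ.+-monoˡ-≤ 5 size≤) (ℕₚ.≤-reflexive (ℕₚ.m∸n+n≡m (ℕₚ.≤-trans (ℕₚ.m≤m+n 5 28) 32<p)))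
  X+2≤p : ∣ X ∣ + 2 ≤ p
  X+2≤p = ℕₚ.≮⇒≥ λ lt → linear 4 (λ x y s p → (s :≡ x :+ y :+ con 1) ∷ (s :+ con 5 :≤ p) ∷ (p :< x :+ con 2) ∷ [])
    (∣ X ∣ ∷ ∣ Y ∣ ∷ ∣ X ⊕ Y ∣ ∷ p ∷ []) size S+5≤p lt
  Y+2<p : ∣ Y ∣ + 2 < p
  Y+2<p = ℕₚ.≰⇒> λ le → linear 4 (λ x y s p → (s :≡ x :+ y :+ con 1) ∷ (s :+ con 5 :≤ p) ∷ (p :≤ y :+ con 2) ∷ [])
    (∣ X ∣ ∷ ∣ Y ∣ ∷ ∣ X ⊕ Y ∣ ∷ p ∷ []) size S+5≤p le
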